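{- Let $P(z)=\sum_{n\ge0}P_nz^n$ be the unique formal power series satisfying $$P=1+zP^2+z^4P^4+z^7P^6+\cdots=1+\frac{zP^2}{1-z^3P^2}.$$ Then the quiddity generating function $Q(z)=\sum_{n\ge 0}Q_nz^n$ satisfies $$Q(z)=1+zP^2+z^4P^5+z^7P^8+\cdots=1+\frac{zP^2}{1-z^3P^3}.$$
   Context: For $n\ge1$, fix a convex $(n+2)$-gon with vertices labelled $0,1,\dots,n+1$ in cyclic order. A dissection is a set of pairwise non-crossing diagonals (chords) of it; these partition the polygon into sub-polygons (cells). The quiddity of a dissection is the tuple $(a_0,\dots,a_{n+1})$, where $a_i$ is the number of cells having vertex $i$. A dissection is 3-periodic if every cell has a number of vertices divisible by $3$. $Q_n$ is the number of distinct tuples that occur as quiddities of 3-periodic dissections of the $(n+2)$-gon, with the convention $Q_0=1$. -}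

module Defs where

open import Data.Bool using (Bool; true; false; _∧_; _∨_; not)
open import Data.Nat using (ℕ; zero; suc; _+_; _*_; _∸_; _≡ᵇ_; _<ᵇ_; _≤ᵇ_)
open import Data.Nat.DivMod using (_%_)
open import Data.Product using (_×_; _,_)
open import Data.List using (List; []; _∷_; _++_; map; length; filterᵇ;
  upTo; cartesianProduct; deduplicate)
open import Data.Nat.ListAction using (sum)
open import Data.Bool.ListAction using (all; any)
open import Data.List.Properties using (≡-dec)
open import Data.Nat.Properties using (_≟_)

-- Combinatorics: dissections of a convex N-gon with vertices 0,…,N-1
-- (in cyclic order).  A chord is written (i , j) with i < j.

Chord : Set
Chord = ℕ × ℕ

isSide : ℕ → Chord → Bool
isSide N (i , j) = (j ≡ᵇ suc i) ∨ ((i ≡ᵇ 0) ∧ (suc j ≡ᵇ N))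

diagonals : ℕ → List Chord
diagonals N =
  filterᵇ (λ c → not (isSide N c))
    (filterᵇ (λ { (i , j) → i <ᵇ j }) (cartesianProduct (upTo N) (upTo N)))

chordEq : Chord → Chord → Bool
chordEq (a , b) (c , d) = (a ≡ᵇ c) ∧ (b ≡ᵇ d)

mem : List Chord → Chord → Bool
mem D c = any (chordEq c) D

crosses : Chord → Chord → Bool
crosses (a , b) (c , d) =
  ((a <ᵇ c) ∧ (c <ᵇ b) ∧ (b <ᵇ d)) ∨ ((c <ᵇ a) ∧ (a <ᵇ d) ∧ (d <ᵇ b))

nonCrossing : List Chord → Bool
nonCrossing D = all (λ c → all (λ d → not (crosses c d)) D) D

sublists : {A : Set} → List A → List (List A)
sublists []       = [] ∷ []
sublists (x ∷ xs) = let r = sublists xs in map (x ∷_) r ++ r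

dissections : ℕ → List (List Chord)
dissections N = filterᵇ nonCrossing (sublists (diagonals N))

isEdge : ℕ → List Chord → Chord → Bool
isEdge N D c = isSide N c ∨ mem D c

adjPairs : List ℕ → List Chord
adjPairs []           = []
adjPairs (x ∷ [])     = []
adjPairs (x ∷ y ∷ xs) = (x , y) ∷ adjPairs (y ∷ xs)

lastOr : ℕ → List ℕ → ℕ
lastOr d []       = d
lastOr d (x ∷ xs) = lastOr x xs

cyclicPairs : List ℕ → List Chord
cyclicPairs []       = []
cyclicPairs (x ∷ xs) = (x , lastOr x xs) ∷ adjPairs (x ∷ xs)

allPairs : List ℕ → List Chord
allPairs []       = []
allPairs (x ∷ xs) = map (x ,_) xs ++ allPairs xs

-- A cell of the dissection D: a set S of ≥ 3 vertices (sorted increasingly)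
-- whose cyclically consecutive vertices are joined by sides or chords of D,
-- and such that no chord of D joins two non-consecutive vertices of S
-- (i.e. no chord of D passes through the interior of the polygon S).
isCell : ℕ → List Chord → List ℕ → Bool
isCell N D S =
  (3 ≤ᵇ length S)
  ∧ all (isEdge N D) (cyclicPairs S)
  ∧ all (λ c → mem (cyclicPairs S) c ∨ not (mem D c)) (allPairs S)

cells : ℕ → List Chord → List (List ℕ)
cells N D = filterᵇ (isCell N D) (sublists (upTo N))

quiddity : ℕ → List Chord → List ℕ
quiddity N D = map (λ i → length (filterᵇ (λ S → any (i ≡ᵇ_) S) (cells N D))) (upTo N)

threePeriodic : ℕ → List Chord → Bool
threePeriodic N D = all (λ S → (length S % 3) ≡ᵇ 0) (cells N D)

-- Q n = number of distinct quiddities of 3-periodic dissections of the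
-- (n+2)-gon, with Q 0 = 1.
Q : ℕ → ℕ
Q zero    = 1
Q (suc m) = length (deduplicate (≡-dec _≟_)
              (map (quiddity N) (filterᵇ (threePeriodic N) (dissections N))))
  where N = m + 3

-- Formal power series with ℕ coefficients, as coefficient sequences.

Series : Set
Series = ℕ → ℕ

one : Series
one zero    = 1
one (suc n) = 0

_⊕_ : Series → Series → Series
(f ⊕ g) n = f n + g n

_⊛_ : Series → Series → Series
(f ⊛ g) n = sum (map (λ k → f k * g (n ∸ k)) (upTo (suc n)))

_^ˢ_ : Series → ℕ → Series
f ^ˢ zero  = one
f ^ˢ suc k = f ⊛ (f ^ˢ k)

shift : ℕ → Series → Series
shift m f n = if' (m ≤ᵇ n)
  where
  if' : Bool → ℕ
  if' true  = f (n ∸ m)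
  if' false = 0

-- Σ_{k ≥ 0} z^{3k+1} F_k : the k-th term has no coefficients below z^{3k+1},
-- so the coefficient of z^n only involves k ≤ n (summing to n is exact).
sumZ3 : (ℕ → Series) → Series
sumZ3 F n = sum (map (λ k → shift (3 * k + 1) (F k) n) (upTo (suc n)))

Prhs : Series → Series
Prhs P = one ⊕ sumZ3 (λ k → P ^ˢ (2 * k + 2))

Qrhs : Series → Series
Qrhs P = one ⊕ sumZ3 (λ k → P ^ˢ (3 * k + 2))

{-# OPTIONS --safe #-}
module Submission where

-- A dissection is a plane tree, rooted at the side (0, n+1): the cell under a
-- chord is a node, and a node with k children is a cell with k+1 vertices.
-- Walking around the tree and writing a letter `corner` for every corner of a
-- cell and a letter `side` for every side of the polygon gives a word whose runs
-- of corners are the quiddity, so quiddities and words are the same thing.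
-- In PSL(2,Z) = Z/2 * Z/3 the word is a closed walk on the tree of triangles:
-- a corner is a step of order 3, and two corners not separated by a side have
-- the step of order 2 between them.  Cutting this walk at its returns gives a
-- canonical ("reduced") tree, in which the children at positions 3, 6, … of every
-- cell but the root cell are leaves: a nontrivial child there would mean that the
-- walk has already returned to the parent cell.  Thus a cell with 3k+3 vertices has
-- 2k+2 free children, which are counted by P, and the root cell has 3k+2 free ones.

open import Defs
open import Data.Bool using (Bool; true; false; T; T?; _∧_; _∨_; not)
open import Data.Bool.ListAction using (all; any)
open import Data.Bool.Properties using (T-∧; T-∨)
open import Data.Empty using (⊥; ⊥-elim)
open import Data.List using (List; []; _∷_; _++_; length; map; filterᵇ; upTo; applyUpTo; cartesianProduct)
open import Data.List.Membership.Propositional using (_∈_)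
open import Data.List.Membership.Propositional.Properties
open import Data.List.Membership.Propositional.Properties.WithK using (unique∧set⇒bag)
open import Data.List.Properties using (∷-injective; length-++; length-map; map-cong; map-upTo; filter-++; ≡-dec)
open import Data.List.Relation.Binary.BagAndSetEquality using (∼bag⇒↭)
open import Data.List.Relation.Binary.Permutation.Propositional using (_↭_; ↭-sym)
open import Data.List.Relation.Binary.Permutation.Propositional.Properties using (↭-length; filter-↭; ∈-resp-↭)
open import Data.List.Relation.Unary.All using (All; []; _∷_)
import Data.List.Relation.Unary.All as All
import Data.List.Relation.Unary.All.Properties as All
open import Data.List.Relation.Unary.AllPairs using (AllPairs; []; _∷_)
import Data.List.Relation.Unary.AllPairs as AllPairs
import Data.List.Relation.Unary.AllPairs.Properties as AllPairs
open import Data.List.Relation.Unary.Any using (here; there)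
import Data.List.Relation.Unary.Any as Any
import Data.List.Relation.Unary.Any.Properties as Any
open import Data.List.Relation.Unary.Unique.DecPropositional.Properties using (deduplicate-!)
open import Data.List.Relation.Unary.Unique.Propositional using (Unique)
import Data.List.Relation.Unary.Unique.Propositional.Properties as Unique
open import Data.Nat using (ℕ; zero; suc; _+_; _*_; _∸_; _≤_; _<_; z≤n; s≤s; _≡ᵇ_; _<ᵇ_; _≤ᵇ_)
open import Data.Nat.Divisibility using (_∣_; divides; m%n≡0⇒n∣m; n∣m⇒m%n≡0)
open import Data.Nat.DivMod using (_%_)
open import Data.Nat.Induction using (<-rec)
open import Data.Nat.ListAction using (sum)
open import Data.Nat.Properties
open import Data.List.Membership.DecPropositional _≟_ using (_∈?_)
open import Data.Nat.Tactic.RingSolver using (solve-∀)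
open import Data.Product using (Σ; ∃; _×_; _,_; proj₁; proj₂)
open import Data.Sum using (_⊎_; inj₁; inj₂; [_,_]′)
open import Data.Unit using (tt)
open import Data.Vec using (Vec; []; _∷_; toList; fromList)
import Data.Vec as Vec
open import Data.Vec.Properties using (toList∘fromList; toList-injective; length-toList; cast-is-id)
open import Function using (_∘_; id; mk⇔; Equivalence)
open import Relation.Binary.PropositionalEquality
open import Relation.Nullary using (¬_; yes; no; contradiction)
open import Relation.Unary using (Decidable)

open Equivalence using (to; from)

-- Words of trees and reduced trees

data Letter : Set where
  corner side : Letter

Word : Set
Word = List Letter

data Tree : Set where
  leaf : Tree
  node : ∀ {k} → Vec Tree (2 + k) → Tree

-- `word t s` is the word of t followed by s.
mutual
  word : Tree → Word → Word
  word leaf      s = side ∷ s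
  word (node ts) s = words ts s

  words : ∀ {k} → Vec Tree k → Word → Word
  words []       s = corner ∷ s
  words (t ∷ ts) s = corner ∷ word t (words ts s)

-- `node k v` has 3k+2 children, of which v lists the 2k+2 free ones in order;
-- the k children at positions 3, 6, … are leaves (see `toTree`).
data Reduced : Set where
  leaf : Reduced
  node : ∀ k → Vec Reduced (suc k * 2) → Reduced

mutual
  code : Reduced → Word → Word
  code leaf                 s = side ∷ s
  code (node k (x ∷ y ∷ v)) s =
    corner ∷ code x (corner ∷ code y (corner ∷ codePairs k v s))

  codePairs : ∀ k → Vec Reduced (k * 2) → Word → Word
  codePairs zero    []          s = s
  codePairs (suc k) (x ∷ y ∷ v) s =
    side ∷ corner ∷ code x (corner ∷ code y (corner ∷ codePairs k v s))

-- The part of a cell boundary that runs along consecutive children: every child has its corner in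
-- front of it, and the closing corner is left to `s`. Hence appending lists of children appends
-- words.
spine : List Reduced → Word → Word
spine []       s = s
spine (r ∷ rs) s = corner ∷ code r (spine rs s)

uncons : ∀ {x y : Letter} {s t} → x ∷ s ≡ y ∷ t → s ≡ t
uncons eq = proj₂ (∷-injective eq)

-- The letter after a pair of children decides whether the node goes on (`side`)
-- or is complete (`corner`), so a reduced tree can be read off from left to right.
mutual
  code-injective : ∀ x y {s t} → code x (corner ∷ s) ≡ code y (corner ∷ t) → x ≡ y × s ≡ t
  code-injective leaf leaf refl = refl , refl
  code-injective leaf (node _ (_ ∷ _ ∷ _)) ()
  code-injective (node _ (_ ∷ _ ∷ _)) leaf ()
  code-injective (node k (x ∷ y ∷ v)) (node k′ (x′ ∷ y′ ∷ v′)) eq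
    with refl , eq₁ ← code-injective x x′ (uncons eq)
    with refl , eq₂ ← code-injective y y′ eq₁
    with refl , refl , eq₃ ← codePairs-injective k k′ v v′ eq₂
    = refl , eq₃

  codePairs-injective : ∀ k k′ v v′ {s t} → codePairs k v (corner ∷ s) ≡ codePairs k′ v′ (corner ∷ t) →
    ∃ λ (k≡k′ : k ≡ k′) → subst (λ j → Vec Reduced (j * 2)) k≡k′ v ≡ v′ × s ≡ t
  codePairs-injective zero zero [] [] refl = refl , refl , refl
  codePairs-injective zero (suc _) [] (_ ∷ _ ∷ _) ()
  codePairs-injective (suc _) zero (_ ∷ _ ∷ _) [] ()
  codePairs-injective (suc k) (suc k′) (x ∷ y ∷ v) (x′ ∷ y′ ∷ v′) eq
    with refl , eq₁ ← code-injective x x′ (uncons (uncons eq))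
    with refl , eq₂ ← code-injective y y′ eq₁
    with refl , refl , eq₃ ← codePairs-injective k k′ v v′ eq₂
    = refl , refl , eq₃

-- Each tree is followed by a corner, namely that of the next tree or the final one, so
-- `code-injective` can split off the trees one at a time. The final corner is recognised because
-- the word stops after it.
spine-injective : ∀ rs rs′ → spine rs (corner ∷ []) ≡ spine rs′ (corner ∷ []) → rs ≡ rs′
spine-injective [] [] _ = refl
spine-injective [] (leaf ∷ _) ()
spine-injective [] (node _ (_ ∷ _ ∷ _) ∷ _) ()
spine-injective (leaf ∷ _) [] ()
spine-injective (node _ (_ ∷ _ ∷ _) ∷ _) [] ()
spine-injective (r ∷ rs) (r′ ∷ rs′) eq = go (tail-corner rs) (tail-corner rs′)
  where
  tail-corner : ∀ rs → ∃ λ s → spine rs (corner ∷ []) ≡ corner ∷ s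
  tail-corner []       = _ , refl
  tail-corner (_ ∷ _) = _ , refl
  go : (∃ λ s → spine rs (corner ∷ []) ≡ corner ∷ s) → (∃ λ s → spine rs′ (corner ∷ []) ≡ corner ∷ s) →
    r ∷ rs ≡ r′ ∷ rs′
  go (s , p) (s′ , p′)
    with refl , refl ← code-injective r r′
           (trans (cong (code r) (sym p)) (trans (uncons eq) (cong (code r′) p′)))
    = cong (r ∷_) (spine-injective rs rs′ (trans p (sym p′)))

spine-++ : ∀ rs rs′ s → spine (rs ++ rs′) s ≡ spine rs (spine rs′ s)
spine-++ []       rs′ s = refl
spine-++ (r ∷ rs) rs′ s = cong (λ z → corner ∷ code r z) (spine-++ rs rs′ s)

-- The children of a node after its first two, with the leaves at positions 3, 6, ... put back.
unpair : ∀ k → Vec Reduced (k * 2) → List Reduced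
unpair zero    []          = []
unpair (suc k) (x ∷ y ∷ v) = leaf ∷ x ∷ y ∷ unpair k v

length-unpair : ∀ k v → length (unpair k v) ≡ k * 3
length-unpair zero    []          = refl
length-unpair (suc k) (x ∷ y ∷ v) = cong (3 +_) (length-unpair k v)

-- `codePairs` writes corners behind the free children and `spine` writes them in front, so the two
-- differ by a shift: the closing corner of the dissolved cell becomes the corner in front of `z`.
spine-unpair : ∀ k v z zs s → corner ∷ codePairs k v (code z (spine zs s)) ≡ spine (unpair k v ++ z ∷ zs) s
spine-unpair zero    []          z zs s = refl
spine-unpair (suc k) (x ∷ y ∷ v) z zs s =
  cong (λ w → corner ∷ side ∷ corner ∷ code x (corner ∷ code y w)) (spine-unpair k v z zs s)

-- A nontrivial tree in a position divisible by 3 is a return of the walk to the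
-- parent cell: the cell is split there and the children of that tree move up.
regroup : ∀ k (rs : Vec Reduced (2 + k * 3)) →
  ∃ λ j → ∃ λ v → ∃ λ zs → ∃ λ m → length zs ≡ m * 3 ×
    (∀ s → spine (toList rs) (corner ∷ s) ≡ code (node j v) (spine zs s))
regroup zero (a ∷ b ∷ []) = 0 , a ∷ b ∷ [] , [] , 0 , refl , λ s → refl
regroup (suc k) (a ∷ b ∷ leaf ∷ rs) with regroup k rs
... | j , x ∷ y ∷ v , zs , m , len , eq =
  suc j , a ∷ b ∷ x ∷ y ∷ v , zs , m , len ,
  λ s → cong (λ w → corner ∷ code a (corner ∷ code b (corner ∷ side ∷ w))) (eq s)
regroup (suc k) (a ∷ b ∷ node i (p ∷ q ∷ w) ∷ rs) with regroup k rs
... | j , v , zs , m , len , eq =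
  -- The corner in front of the third child closes `node 0`. The 3i+2 children of that child, the
  -- tree `node j v` and the 3m trees `zs` are then siblings, and their number is 3(i+m+1).
  0 , a ∷ b ∷ [] , p ∷ q ∷ unpair i w ++ node j v ∷ zs , suc (i + m) ,
  trans (cong (2 +_) (trans (length-++ (unpair i w)) (cong₂ (λ a b → a + suc b) (length-unpair i w) len)))
    (arith i m) ,
  λ s → cong (λ u → corner ∷ code a (corner ∷ code b (corner ∷ u)))
    (trans (cong (λ u → corner ∷ code p (corner ∷ code q (corner ∷ codePairs i w u))) (eq s))
      (cong (λ u → corner ∷ code p (corner ∷ code q u)) (spine-unpair i w (node j v) zs s)))
  where
  arith : ∀ i m → 2 + (i * 3 + suc (m * 3)) ≡ suc (i + m) * 3
  arith = solve-∀

mutual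
  toTree : Reduced → Tree
  toTree leaf                 = leaf
  toTree (node k (x ∷ y ∷ v)) = node (toTree x ∷ toTree y ∷ toForest k v)

  toForest : ∀ k → Vec Reduced (k * 2) → Vec Tree (k * 3)
  toForest zero    []          = []
  toForest (suc k) (x ∷ y ∷ v) = leaf ∷ toTree x ∷ toTree y ∷ toForest k v

mutual
  word-toTree : ∀ r s → word (toTree r) s ≡ code r s
  word-toTree leaf s = refl
  word-toTree (node k (x ∷ y ∷ v)) s = cong (corner ∷_)
    (trans (word-toTree x _) (cong (λ w → code x (corner ∷ w))
      (trans (word-toTree y _) (cong (code y) (words-toForest k v s)))))

  words-toForest : ∀ k v s → words (toForest k v) s ≡ corner ∷ codePairs k v s
  words-toForest zero    []          s = refl
  words-toForest (suc k) (x ∷ y ∷ v) s = cong (λ w → corner ∷ side ∷ corner ∷ w)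
    (trans (word-toTree x _) (cong (λ w → code x (corner ∷ w))
      (trans (word-toTree y _) (cong (code y) (words-toForest k v s)))))

-- The number of sides in a word

sides : Word → ℕ
sides []           = 0
sides (corner ∷ s) = sides s
sides (side ∷ s)   = suc (sides s)

mutual
  -- One less than the number of sides in the code, as `sides-code` shows. This is the exponent of
  -- z: a cell with 3k+2 children contributes the factor z^(3k+1).
  size : Reduced → ℕ
  size leaf       = 0
  size (node k v) = 3 * k + 1 + sizes v

  sizes : ∀ {m} → Vec Reduced m → ℕ
  sizes []      = 0
  sizes (r ∷ v) = size r + sizes v

mutual
  sides-code : ∀ r s → sides (code r s) ≡ suc (size r + sides s)
  sides-code leaf s = refl
  sides-code (node k (x ∷ y ∷ v)) s
    rewrite sides-code x (corner ∷ code y (corner ∷ codePairs k v s))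
          | sides-code y (corner ∷ codePairs k v s)
          | sides-codePairs k v s
          = arith k (size x) (size y) (sizes v) (sides s)
    where
    arith : ∀ k x y v s → suc (x + suc (y + (k * 3 + v + s))) ≡ suc (3 * k + 1 + (x + (y + v)) + s)
    arith = solve-∀

  sides-codePairs : ∀ k v s → sides (codePairs k v s) ≡ k * 3 + sizes v + sides s
  sides-codePairs zero    []          s = refl
  sides-codePairs (suc k) (x ∷ y ∷ v) s
    rewrite sides-code x (corner ∷ code y (corner ∷ codePairs k v s))
          | sides-code y (corner ∷ codePairs k v s)
          | sides-codePairs k v s
          = arith k (size x) (size y) (sizes v) (sides s)
    where
    arith : ∀ k x y v s → suc (suc (x + suc (y + (k * 3 + v + s)))) ≡ suc k * 3 + (x + (y + v)) + s
    arith = solve-∀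

sides-spine : ∀ {m} (v : Vec Reduced m) s → sides (spine (toList v) s) ≡ m + sizes v + sides s
sides-spine []      s = refl
sides-spine {suc m} (r ∷ v) s
  rewrite sides-code r (spine (toList v) s) | sides-spine v s = arith m (size r) (sizes v) (sides s)
  where
  arith : ∀ m r v s → suc (r + (m + v + s)) ≡ suc m + (r + v) + s
  arith = solve-∀

-- Edges and cells of trees

mutual
  -- Vertices are numbered along the walk, and each leaf advances the number by one; a tree placed
  -- at vertex `l` has `(l , treeEnd t l)` as its root edge.
  treeEnd : Tree → ℕ → ℕ
  treeEnd leaf      l = suc l
  treeEnd (node ts) l = forestEnd ts l

  forestEnd : ∀ {k} → Vec Tree k → ℕ → ℕ
  forestEnd []       l = l
  forestEnd (t ∷ ts) l = forestEnd ts (treeEnd t l)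

mutual
  treeEdges : Tree → ℕ → List Chord
  treeEdges leaf      l = (l , suc l) ∷ []
  treeEdges (node ts) l = (l , forestEnd ts l) ∷ forestEdges ts l

  forestEdges : ∀ {k} → Vec Tree k → ℕ → List Chord
  forestEdges []       l = []
  forestEdges (t ∷ ts) l = treeEdges t l ++ forestEdges ts (treeEnd t l)

-- The vertices of the cell with children `ts`; with fewer children, the rest of a cell from `l` on.
path : ∀ {k} → Vec Tree k → ℕ → List ℕ
path []       l = l ∷ []
path (t ∷ ts) l = l ∷ path ts (treeEnd t l)

mutual
  treeCells : Tree → ℕ → List (List ℕ)
  treeCells leaf      l = []
  treeCells (node ts) l = path ts l ∷ forestCells ts l

  forestCells : ∀ {k} → Vec Tree k → ℕ → List (List ℕ)
  forestCells []       l = []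
  forestCells (t ∷ ts) l = treeCells t l ++ forestCells ts (treeEnd t l)

mutual
  l<treeEnd : ∀ t l → l < treeEnd t l
  l<treeEnd leaf               l = ≤-refl
  l<treeEnd (node (t ∷ ts)) l = <-≤-trans (l<treeEnd t l) (l≤forestEnd ts _)

  l≤forestEnd : ∀ {k} (ts : Vec Tree k) l → l ≤ forestEnd ts l
  l≤forestEnd []       l = ≤-refl
  l≤forestEnd (t ∷ ts) l = ≤-trans (<⇒≤ (l<treeEnd t l)) (l≤forestEnd ts _)

root∈treeEdges : ∀ t l → (l , treeEnd t l) ∈ treeEdges t l
root∈treeEdges leaf      l = here refl
root∈treeEdges (node ts) l = here refl

mutual
  treeEdges-bounds : ∀ t l {i j} → (i , j) ∈ treeEdges t l → l ≤ i × i < j × j ≤ treeEnd t l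
  treeEdges-bounds leaf      l (here refl) = ≤-refl , ≤-refl , ≤-refl
  treeEdges-bounds (node ts@(_ ∷ _)) l (here refl) = ≤-refl , l<treeEnd (node ts) l , ≤-refl
  treeEdges-bounds (node ts) l (there p)   = forestEdges-bounds ts l p

  forestEdges-bounds : ∀ {k} (ts : Vec Tree k) l {i j} → (i , j) ∈ forestEdges ts l →
    l ≤ i × i < j × j ≤ forestEnd ts l
  forestEdges-bounds (t ∷ ts) l p with ∈-++⁻ (treeEdges t l) p
  ... | inj₁ q = let a , b , c = treeEdges-bounds t l q in a , b , ≤-trans c (l≤forestEnd ts _)
  ... | inj₂ q = let a , b , c = forestEdges-bounds ts _ q in ≤-trans (<⇒≤ (l<treeEnd t l)) a , b , c

forestEdges-left : ∀ {k} t (ts : Vec Tree k) l {i j} → j ≤ treeEnd t l →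
  (i , j) ∈ forestEdges (t ∷ ts) l → (i , j) ∈ treeEdges t l
forestEdges-left t ts l j≤ p with ∈-++⁻ (treeEdges t l) p
... | inj₁ q = q
... | inj₂ q = let a , b , _ = forestEdges-bounds ts _ q in contradiction (≤-trans j≤ a) (<⇒≱ b)

forestEdges-right : ∀ {k} t (ts : Vec Tree k) l {i j} → treeEnd t l ≤ i →
  (i , j) ∈ forestEdges (t ∷ ts) l → (i , j) ∈ forestEdges ts (treeEnd t l)
forestEdges-right t ts l ≤i p with ∈-++⁻ (treeEdges t l) p
... | inj₁ q = let _ , b , c = treeEdges-bounds t l q in contradiction (≤-trans c ≤i) (<⇒≱ b)
... | inj₂ q = q

-- Every edge lies over a single child, and with at least two children none of them spans the whole
-- range. This separates the root cell from the cells below it.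
root∉forestEdges : ∀ {k} (ts : Vec Tree (2 + k)) l → ¬ (l , forestEnd ts l) ∈ forestEdges ts l
root∉forestEdges (t ∷ ts@(t′ ∷ ts′)) l p with ∈-++⁻ (treeEdges t l) p
... | inj₁ q = let _ , _ , c = treeEdges-bounds t l q in
  <⇒≱ (<-≤-trans (l<treeEnd t′ _) (l≤forestEnd ts′ _)) c
... | inj₂ q = let a , _ , _ = forestEdges-bounds ts _ q in <⇒≱ (l<treeEnd t l) a

-- Pairs in sorted lists, and cells of an edge set

adj⊆all : ∀ xs {c} → c ∈ adjPairs xs → c ∈ allPairs xs
adj⊆all (x ∷ y ∷ xs) (here refl) = here refl
adj⊆all (x ∷ y ∷ xs) (there p)   = ∈-++⁺ʳ (map (x ,_) (y ∷ xs)) (adj⊆all (y ∷ xs) p)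

lastOr-∈ : ∀ x xs → lastOr x xs ∈ x ∷ xs
lastOr-∈ x []       = here refl
lastOr-∈ x (y ∷ xs) = there (lastOr-∈ y xs)

∈⇒≤last : ∀ {x xs} → AllPairs _<_ (x ∷ xs) → ∀ {y} → y ∈ x ∷ xs → y ≤ lastOr x xs
∈⇒≤last {xs = []}     _       (here refl) = ≤-refl
∈⇒≤last {xs = _ ∷ _} (p ∷ s) (here refl) = <⇒≤ (All.lookup p (lastOr-∈ _ _))
∈⇒≤last {xs = _ ∷ _} (p ∷ s) (there y∈)  = ∈⇒≤last s y∈

allPairs⁻ : ∀ x xs {i j} → (i , j) ∈ allPairs (x ∷ xs) → (i ≡ x × j ∈ xs) ⊎ (i , j) ∈ allPairs xs
allPairs⁻ x xs p with ∈-++⁻ (map (x ,_) xs) p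
... | inj₂ q = inj₂ q
... | inj₁ q with _ , y∈ , refl ← ∈-map⁻ (x ,_) q = inj₁ (refl , y∈)

allPairs-∈ : ∀ xs {i j} → (i , j) ∈ allPairs xs → i ∈ xs × j ∈ xs
allPairs-∈ (x ∷ xs) p with allPairs⁻ x xs p
... | inj₁ (refl , j∈) = here refl , there j∈
... | inj₂ q = let a , b = allPairs-∈ xs q in there a , there b

allPairs-< : ∀ {xs} → AllPairs _<_ xs → ∀ {i j} → (i , j) ∈ allPairs xs → i < j
allPairs-< {x ∷ xs} (p ∷ s) q with allPairs⁻ x xs q
... | inj₁ (refl , j∈) = All.lookup p j∈
... | inj₂ r = allPairs-< s r

∈⇒≥head : ∀ {x xs} → AllPairs _<_ (x ∷ xs) → ∀ {y} → y ∈ x ∷ xs → x ≤ y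
∈⇒≥head _       (here refl) = ≤-refl
∈⇒≥head (p ∷ _) (there y∈)  = <⇒≤ (All.lookup p y∈)

cyclic⊆all : ∀ x y xs {c} → c ∈ cyclicPairs (x ∷ y ∷ xs) → c ∈ allPairs (x ∷ y ∷ xs)
cyclic⊆all x y xs (here refl) = ∈-++⁺ˡ (∈-map⁺ (x ,_) (lastOr-∈ y xs))
cyclic⊆all x y xs (there p)   = adj⊆all (x ∷ y ∷ xs) p

-- The propositional form of `isCell` for any edge set. Here `empty` treats sides of the polygon and
-- chords alike, so that a single predicate `E` suffices.
record Cell (E : Chord → Set) (S : List ℕ) : Set where
  constructor mkCell
  field
    sorted : AllPairs _<_ S
    long   : 3 ≤ length S
    closed : ∀ {c} → c ∈ cyclicPairs S → E c
    empty  : ∀ {c} → c ∈ allPairs S → E c → c ∈ cyclicPairs S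

-- All pairs of vertices of a cell lie between its first and last vertex, so only edges in that
-- range matter. This moves cells between a tree, its subtrees and the polygon.
Cell-local : ∀ {E E′ : Chord → Set} {x xs} →
  (∀ {i j} → x ≤ i → i < j → j ≤ lastOr x xs → E (i , j) → E′ (i , j)) →
  (∀ {i j} → x ≤ i → i < j → j ≤ lastOr x xs → E′ (i , j) → E (i , j)) →
  Cell E (x ∷ xs) → Cell E′ (x ∷ xs)
Cell-local {E} {E′} {x} {xs = xs@(y ∷ ys)} to from (mkCell so lo cl em) = mkCell so lo
  (λ {(_ , _)} p → within to (cyclic⊆all x y ys p) (cl p))
  (λ {(_ , _)} p e → em p (within from p e))
  where
  within : ∀ {F F′ : Chord → Set} →
    (∀ {i j} → x ≤ i → i < j → j ≤ lastOr x xs → F (i , j) → F′ (i , j)) →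
    ∀ {i j} → (i , j) ∈ allPairs (x ∷ xs) → F (i , j) → F′ (i , j)
  within imp p = let i∈ , j∈ = allPairs-∈ (x ∷ xs) p in
    imp (∈⇒≥head so i∈) (allPairs-< so p) (∈⇒≤last so j∈)
Cell-local {xs = []} to from (mkCell _ (s≤s ()) _ _)

path-sorted : ∀ {k} (ts : Vec Tree k) l → All (l ≤_) (path ts l) × AllPairs _<_ (path ts l)
path-sorted []       l = ≤-refl ∷ [] , [] ∷ []
path-sorted (t ∷ ts) l = let a , s = path-sorted ts (treeEnd t l) in
  ≤-refl ∷ All.map (≤-trans (<⇒≤ (l<treeEnd t l))) a , All.map (<-≤-trans (l<treeEnd t l)) a ∷ s

length-path : ∀ {k} (ts : Vec Tree k) l → length (path ts l) ≡ suc k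
length-path []       l = refl
length-path (t ∷ ts) l = cong suc (length-path ts _)

lastOr-path : ∀ {k} (ts : Vec Tree k) l d → lastOr d (path ts l) ≡ forestEnd ts l
lastOr-path []       l d = refl
lastOr-path (t ∷ ts) l d = lastOr-path ts _ l

path-closed : ∀ {k} (ts : Vec Tree k) l {c} → c ∈ adjPairs (path ts l) → c ∈ forestEdges ts l
path-closed (t ∷ [])          l (here refl) = ∈-++⁺ˡ (root∈treeEdges t l)
path-closed (t ∷ ts@(_ ∷ _)) l (here refl) = ∈-++⁺ˡ (root∈treeEdges t l)
path-closed (t ∷ ts@(_ ∷ _)) l (there p)   = ∈-++⁺ʳ (treeEdges t l) (path-closed ts _ p)

head-adj : ∀ {k} (ts : Vec Tree k) x l → (x , l) ∈ adjPairs (x ∷ path ts l)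
head-adj []       x l = here refl
head-adj (_ ∷ _) x l = here refl

tail-adj : ∀ {k} (ts : Vec Tree k) x l {c} → c ∈ adjPairs (path ts l) → c ∈ adjPairs (x ∷ path ts l)
tail-adj []       x l p = there p
tail-adj (_ ∷ _) x l p = there p

path-empty : ∀ {k} (ts : Vec Tree k) l {c} → c ∈ allPairs (path ts l) → c ∈ forestEdges ts l →
  c ∈ adjPairs (path ts l)
path-empty (t ∷ ts) l {i , j} p e with allPairs⁻ l (path ts (treeEnd t l)) p
... | inj₂ q = tail-adj ts l _ (path-empty ts _ q
        (forestEdges-right t ts l (All.lookup (proj₁ (path-sorted ts _)) (proj₁ (allPairs-∈ _ q))) e))
... | inj₁ (refl , j∈) with ∈-++⁻ (treeEdges t l) e
...   | inj₂ f = contradiction (proj₁ (forestEdges-bounds ts _ f)) (<⇒≱ (l<treeEnd t l))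
...   | inj₁ f with refl ← ≤-antisym (proj₂ (proj₂ (treeEdges-bounds t l f))) (All.lookup (proj₁ (path-sorted ts _)) j∈)
      = head-adj ts l _

path-Cell : ∀ {k} (ts : Vec Tree (2 + k)) l → Cell (_∈ treeEdges (node ts) l) (path ts l)
path-Cell ts@(t ∷ ts′@(_ ∷ _)) l = mkCell (proj₂ (path-sorted ts l))
  (subst (3 ≤_) (sym (length-path ts l)) (s≤s (s≤s (s≤s z≤n))))
  (λ { (here refl) → here (cong (l ,_) (lastOr-path ts′ _ l)) ; (there p) → there (path-closed ts l p) })
  (λ { {c} p (here refl) → here (cong (l ,_) (sym (lastOr-path ts′ _ l)))
     ; p (there e) → there (path-empty ts l p e) })

Cell-bounds : ∀ {E : Chord → Set} {x xs} → Cell E (x ∷ xs) → E (x , lastOr x xs)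
Cell-bounds c = Cell.closed c (here refl)

under-root : ∀ {k} (ts : Vec Tree (2 + k)) l {x y} → (x , y) ∈ forestEdges ts l →
  ∀ {i j} → x ≤ i → i < j → j ≤ y → (i , j) ∈ treeEdges (node ts) l → (i , j) ∈ forestEdges ts l
under-root ts l xy x≤i _ j≤y (there p) = p
under-root ts l xy x≤i _ j≤y (here refl)
  with l≤x , _ , y≤e ← forestEdges-bounds ts l xy
  with refl ← ≤-antisym x≤i l≤x | refl ← ≤-antisym j≤y y≤e = contradiction xy (root∉forestEdges ts l)

-- The cells of a tree are the cells of its edge set

mutual
  treeCells-sound : ∀ t l {S} → S ∈ treeCells t l → Cell (_∈ treeEdges t l) S
  treeCells-sound (node ts) l (here refl) = path-Cell ts l
  treeCells-sound (node ts) l {[]} (there p) with mkCell _ () _ _ ← forestCells-sound ts l p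
  treeCells-sound (node ts) l {x ∷ xs} (there p) = let c = forestCells-sound ts l p in
    Cell-local (λ _ _ _ → there) (under-root ts l (Cell-bounds c)) c

  forestCells-sound : ∀ {k} (ts : Vec Tree k) l {S} → S ∈ forestCells ts l → Cell (_∈ forestEdges ts l) S
  forestCells-sound (t ∷ ts) l {S} p with ∈-++⁻ (treeCells t l) p
  forestCells-sound (t ∷ ts) l {[]} p | inj₁ q with mkCell _ () _ _ ← treeCells-sound t l q
  forestCells-sound (t ∷ ts) l {[]} p | inj₂ q with mkCell _ () _ _ ← forestCells-sound ts _ q
  forestCells-sound (t ∷ ts) l {x ∷ xs} p | inj₁ q = let c = treeCells-sound t l q in
    Cell-local (λ _ _ _ → ∈-++⁺ˡ)
      (λ _ _ j≤ → forestEdges-left t ts l (≤-trans j≤ (proj₂ (proj₂ (treeEdges-bounds t l (Cell-bounds c)))))) c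
  forestCells-sound (t ∷ ts) l {x ∷ xs} p | inj₂ q = let c = forestCells-sound ts _ q in
    Cell-local (λ _ _ _ → ∈-++⁺ʳ (treeEdges t l))
      (λ x≤ _ _ → forestEdges-right t ts l (≤-trans (proj₁ (forestEdges-bounds ts _ (Cell-bounds c))) x≤)) c

-- A discrete intermediate value argument: if no step jumps over `u`, the walk from `a` to its end
-- must stop there.
passes : ∀ {u} a xs → a ≤ u → u ≤ lastOr a xs →
  (∀ {p q} → (p , q) ∈ adjPairs (a ∷ xs) → q ≤ u ⊎ u ≤ p) → u ∈ a ∷ xs
passes a []       a≤u u≤a _  = here (≤-antisym u≤a a≤u)
passes {u} a (b ∷ xs) a≤u u≤  sp with sp (here refl)
... | inj₁ b≤u = there (passes b xs b≤u u≤ (sp ∘ there))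
... | inj₂ u≤a = here (≤-antisym u≤a a≤u)

adj-head : ∀ {x xs} → AllPairs _<_ (x ∷ xs) → ∀ {u} → (x , u) ∈ adjPairs (x ∷ xs) → ∃ λ ys → xs ≡ u ∷ ys
adj-head {xs = y ∷ ys} _ (here refl) = ys , refl
adj-head {xs = y ∷ ys} (p ∷ s) (there q) =
  contradiction (∈⇒≥head s (proj₁ (allPairs-∈ _ (adj⊆all _ q)))) (<⇒≱ (All.lookup p (here refl)))

-- No edge jumps over the end of the first child, so by `passes` that end is a vertex of the cell.
-- It is joined to `l` by an edge, so emptiness makes it the very next vertex, and the remaining
-- children follow by induction.
path-unique : ∀ {k} (ts : Vec Tree k) l xs → AllPairs _<_ (l ∷ xs) → lastOr l xs ≡ forestEnd ts l →
  (∀ {c} → c ∈ adjPairs (l ∷ xs) → c ∈ forestEdges ts l) →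
  (∀ {c} → c ∈ allPairs (l ∷ xs) → c ∈ forestEdges ts l → c ∈ adjPairs (l ∷ xs)) →
  l ∷ xs ≡ path ts l
path-unique []       l []       so la cl em = refl
path-unique []       l (y ∷ xs) so la cl em with () ← cl (here refl)
path-unique (t ∷ ts) l xs so@(l< ∷ so′) la cl em
  with passes l xs (<⇒≤ (l<treeEnd t l)) (subst (treeEnd t l ≤_) (sym la) (l≤forestEnd ts _)) split
  where
  split : ∀ {p q} → (p , q) ∈ adjPairs (l ∷ xs) → q ≤ treeEnd t l ⊎ treeEnd t l ≤ p
  split c with ∈-++⁻ (treeEdges t l) (cl c)
  ... | inj₁ e = inj₁ (proj₂ (proj₂ (treeEdges-bounds t l e)))
  ... | inj₂ e = inj₂ (proj₁ (forestEdges-bounds ts _ e))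
... | here u≡l = contradiction (l<treeEnd t l) (<-irrefl (sym u≡l))
... | there u∈
  with ys , refl ← adj-head so (em (∈-++⁺ˡ (∈-map⁺ (l ,_) u∈)) (∈-++⁺ˡ (root∈treeEdges t l)))
  = cong (l ∷_) (path-unique ts (treeEnd t l) ys so′ la
      (λ {(_ , _)} c → forestEdges-right t ts l (after (adj⊆all _ c)) (cl (there c)))
      (λ {(_ , _)} c e → drop (after c) (em (∈-++⁺ʳ (map (l ,_) (treeEnd t l ∷ ys)) c) (∈-++⁺ʳ (treeEdges t l) e))))
  where
  after : ∀ {i j} → (i , j) ∈ allPairs (treeEnd t l ∷ ys) → treeEnd t l ≤ i
  after c = ∈⇒≥head so′ (proj₁ (allPairs-∈ _ c))
  drop : ∀ {i j} → treeEnd t l ≤ i → (i , j) ∈ adjPairs (l ∷ treeEnd t l ∷ ys) →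
    (i , j) ∈ adjPairs (treeEnd t l ∷ ys)
  drop u≤l (here refl) = contradiction u≤l (<⇒≱ (l<treeEnd t l))
  drop _   (there c)   = c

mutual
  -- The edge from the first to the last vertex of a cell decides where the cell sits: if it is the
  -- root edge, `path-unique` applies; otherwise the cell lies below one of the children.
  treeCells-complete : ∀ t l {S} → Cell (_∈ treeEdges t l) S → S ∈ treeCells t l
  treeCells-complete t l {[]} (mkCell _ () _ _)
  treeCells-complete t l {_ ∷ []} (mkCell _ (s≤s ()) _ _)
  treeCells-complete t l {_ ∷ _ ∷ []} (mkCell _ (s≤s (s≤s ())) _ _)
  treeCells-complete leaf l {x ∷ y ∷ z ∷ r} c@(mkCell (x< ∷ y< ∷ _) _ _ _) with Cell-bounds c
  ... | here eq with refl ← cong proj₁ eq = contradiction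
        (<-≤-trans (s≤s (All.lookup x< (here refl))) (≤-trans (All.lookup y< (lastOr-∈ z r)) (≤-reflexive (cong proj₂ eq))))
        (<-irrefl refl)
  treeCells-complete (node ts) l {x ∷ xs@(y ∷ z ∷ r)} c@(mkCell so@(x< ∷ y< ∷ _) _ cl em) with Cell-bounds c
  ... | there p = there (forestCells-complete ts l (Cell-local (under-root ts l p) (λ _ _ _ → there) c))
  ... | here eq with refl ← cong proj₁ eq = here (path-unique ts l xs so (cong proj₂ eq)
        (λ q → notRoot q (cl (there q)))
        (λ q e → notLast e (em q (there e))))
    where
    notRoot : ∀ {c} → c ∈ adjPairs (x ∷ xs) → c ∈ treeEdges (node ts) l → c ∈ forestEdges ts l
    notRoot q (there e) = e
    -- If the root edge joined two consecutive vertices, the second vertex would already be the last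
    -- one, but a cell has at least three.
    notRoot q (here refl) with _ , e ← adj-head so q = contradiction
      (trans (cong proj₂ eq) (sym (cong (λ { [] → 0 ; (w ∷ _) → w }) e)))
      (<⇒≢ (All.lookup y< (lastOr-∈ z r)) ∘ sym)
    notLast : ∀ {c} → c ∈ forestEdges ts l → c ∈ cyclicPairs (x ∷ xs) → c ∈ adjPairs (x ∷ xs)
    notLast e (there q) = q
    notLast e (here refl) = contradiction (subst (λ z → (x , z) ∈ forestEdges ts x) (cong proj₂ eq) e) (root∉forestEdges ts l)

  forestCells-complete : ∀ {k} (ts : Vec Tree k) l {S} → Cell (_∈ forestEdges ts l) S → S ∈ forestCells ts l
  forestCells-complete ts l {[]} (mkCell _ () _ _)
  forestCells-complete [] l {x ∷ xs} c with () ← Cell-bounds c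
  forestCells-complete (t ∷ ts) l {x ∷ xs} c with ∈-++⁻ (treeEdges t l) (Cell-bounds c)
  ... | inj₁ q = ∈-++⁺ˡ (treeCells-complete t l (Cell-local
    (λ _ _ j≤ → forestEdges-left t ts l (≤-trans j≤ (proj₂ (proj₂ (treeEdges-bounds t l q))))) (λ _ _ _ → ∈-++⁺ˡ) c))
  ... | inj₂ q = ∈-++⁺ʳ (treeCells t l) (forestCells-complete ts _ (Cell-local
    (λ x≤ _ _ → forestEdges-right t ts l (≤-trans (proj₁ (forestEdges-bounds ts _ q)) x≤)) (λ _ _ _ → ∈-++⁺ʳ (treeEdges t l)) c))

mutual
  -- The root cell is bounded by the root edge, which bounds no cell below it, and cells of
  -- different children are bounded by edges whose ranges share at most an endpoint.
  treeCells-unique : ∀ t l → Unique (treeCells t l)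
  treeCells-unique leaf      l = []
  treeCells-unique (node ts) l = All.tabulate (λ S∈ eq → path∉ ts (subst (_∈ forestCells ts l) (sym eq) S∈)) ∷ forestCells-unique ts l
    where
    path∉ : ∀ {k} (ts : Vec Tree (2 + k)) → ¬ path ts l ∈ forestCells ts l
    path∉ ts@(t ∷ ts′) p = root∉forestEdges ts l
      (subst (λ z → (l , z) ∈ forestEdges ts l) (lastOr-path ts′ _ l) (Cell-bounds (forestCells-sound ts l p)))

  forestCells-unique : ∀ {k} (ts : Vec Tree k) l → Unique (forestCells ts l)
  forestCells-unique []       l = []
  forestCells-unique (t ∷ ts) l = Unique.++⁺ (treeCells-unique t l) (forestCells-unique ts _) disjoint
    where
    disjoint : ∀ {S} → S ∈ treeCells t l × S ∈ forestCells ts (treeEnd t l) → ⊥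
    disjoint {[]} (p , q) with mkCell _ () _ _ ← treeCells-sound t l p
    disjoint {x ∷ xs} (p , q) =
      let _ , x<y , y≤ = treeEdges-bounds t l (Cell-bounds (treeCells-sound t l p))
          ≤x , _ = forestEdges-bounds ts _ (Cell-bounds (forestCells-sound ts _ q))
      in <⇒≱ x<y (≤-trans y≤ ≤x)

-- Words and vertex counts

bump : List ℕ → List ℕ
bump []       = []
bump (a ∷ as) = suc a ∷ as

decode : Word → List ℕ
decode []           = 0 ∷ []
decode (side ∷ s)   = 0 ∷ decode s
decode (corner ∷ s) = bump (decode s)

decode-injective : ∀ s t → decode s ≡ decode t → s ≡ t
decode-injective s t eq = trans (sym (encode-decode s)) (trans (cong encode eq) (encode-decode t))
  where
  encode : List ℕ → Word
  encode′ : List ℕ → Word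
  encode [] = []
  encode (zero ∷ as) = encode′ as
  encode (suc a ∷ as) = corner ∷ encode (a ∷ as)
  -- A side is written only if another entry follows: a word with n sides has n+1 runs of corners.
  encode′ [] = []
  encode′ as@(_ ∷ _) = side ∷ encode as
  decode-∷ : ∀ s → ∃ λ a → ∃ λ as → decode s ≡ a ∷ as
  decode-∷ [] = _ , _ , refl
  decode-∷ (side ∷ s) = _ , _ , refl
  decode-∷ (corner ∷ s) with a , as , eq ← decode-∷ s rewrite eq = _ , _ , refl
  encode-decode : ∀ s → encode (decode s) ≡ s
  encode-decode [] = refl
  encode-decode (side ∷ s) with decode s | decode-∷ s | encode-decode s
  ... | _ | a , as , refl | eq = cong (side ∷_) eq
  encode-decode (corner ∷ s) with decode s | decode-∷ s | encode-decode s
  ... | _ | a , as , refl | eq = cong (corner ∷_) eq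

table : (ℕ → ℕ) → ℕ → ℕ → List ℕ
table f l zero    = f l ∷ []
table f l (suc k) = f l ∷ table f (suc l) k

table-cong : ∀ {f g} l k → (∀ {i} → l ≤ i → f i ≡ g i) → table f l k ≡ table g l k
table-cong l zero    eq = cong (_∷ []) (eq ≤-refl)
table-cong l (suc k) eq = cong₂ _∷_ (eq ≤-refl) (table-cong (suc l) k (eq ∘ ≤-trans (n≤1+n l)))

table-applyUpTo : ∀ f l k → table f l k ≡ applyUpTo (λ i → f (i + l)) (suc k)
table-applyUpTo f l zero    = refl
table-applyUpTo f l (suc k) = cong (f l ∷_) (trans (table-applyUpTo f (suc l) k)
  (applyUpTo-cong (suc k) λ i → cong f (+-suc i l)))
  where
  applyUpTo-cong : ∀ {f g : ℕ → ℕ} n → (∀ i → f i ≡ g i) → applyUpTo f n ≡ applyUpTo g n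
  applyUpTo-cong zero    eq = refl
  applyUpTo-cong (suc n) eq = cong₂ _∷_ (eq 0) (applyUpTo-cong n (eq ∘ suc))

table-upTo : ∀ f k → table f 0 k ≡ map f (upTo (suc k))
table-upTo f k = trans (table-applyUpTo f 0 k)
  (trans (sym (map-upTo (λ i → f (i + 0)) (suc k))) (map-cong (λ i → cong f (+-identityʳ i)) (upTo (suc k))))

-- The rest `s` of the walk starts at vertex `l`, and `f` gives the number of corners that it still
-- has at each vertex.
Spells : (ℕ → ℕ) → ℕ → Word → Set
Spells f l s = decode s ≡ table f l (sides s)

spells-side : ∀ {f g l s} → f l ≡ 0 → (∀ {i} → l < i → f i ≡ g i) → Spells g (suc l) s →
  Spells f l (side ∷ s)
spells-side f0 eq sp = cong₂ _∷_ (sym f0) (trans sp (table-cong _ _ (sym ∘ eq)))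

spells-corner : ∀ {f g l s} → f l ≡ suc (g l) → (∀ {i} → l < i → f i ≡ g i) → Spells g l s →
  Spells f l (corner ∷ s)
spells-corner {f} {g} {l} {s} fl eq sp = trans (cong bump sp) (lemma (sides s))
  where
  lemma : ∀ k → bump (table g l k) ≡ table f l k
  lemma zero    = cong (_∷ []) (sym fl)
  lemma (suc k) = cong₂ _∷_ (sym fl) (table-cong _ k (sym ∘ eq))

occ : List (List ℕ) → ℕ → ℕ
occ L i = length (filterᵇ (λ S → any (i ≡ᵇ_) S) L)

occ-++ : ∀ L L′ i → occ (L ++ L′) i ≡ occ L i + occ L′ i
occ-++ L L′ i = trans (cong length (filter-++ _ L L′)) (length-++ (filterᵇ (λ S → any (i ≡ᵇ_) S) L))

any-∈ : ∀ {i S} → i ∈ S → T (any (i ≡ᵇ_) S)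
any-∈ {i} i∈ = Any.any⁺ _ (Any.map (≡⇒≡ᵇ i _) i∈)

∈-any : ∀ {i} S → T (any (i ≡ᵇ_) S) → i ∈ S
∈-any {i} S p = Any.map (≡ᵇ⇒≡ i _) (Any.any⁻ _ S p)

occ-∈ : ∀ {i} S L → i ∈ S → occ (S ∷ L) i ≡ suc (occ L i)
occ-∈ {i} S L i∈ with any (i ≡ᵇ_) S | any-∈ {i} {S} i∈
... | true | _ = refl

occ-∉ : ∀ {i} S L → ¬ i ∈ S → occ (S ∷ L) i ≡ occ L i
occ-∉ {i} S L i∉ with any (i ≡ᵇ_) S | ∈-any {i} S
... | false | _ = refl
... | true  | f = contradiction (f tt) i∉

occ-none : ∀ {i} L → (∀ {S} → S ∈ L → ¬ i ∈ S) → occ L i ≡ 0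
occ-none []      avoid = refl
occ-none (S ∷ L) avoid = trans (occ-∉ S L (avoid (here refl))) (occ-none L (avoid ∘ there))

occ-path∷ : ∀ {l i} S L → l < i → occ ((l ∷ S) ∷ L) i ≡ occ (S ∷ L) i
occ-path∷ {l} {i} S L l<i with i ∈? S
... | yes i∈ = trans (occ-∈ (l ∷ S) L (there i∈)) (sym (occ-∈ S L i∈))
... | no  i∉ = trans (occ-∉ {i} (l ∷ S) L (λ { (here refl) → <-irrefl refl l<i ; (there p) → i∉ p })) (sym (occ-∉ {i} S L i∉))

Cell-∈ : ∀ {E : Chord → Set} {S i} → Cell E S → i ∈ S → ∃ λ x → ∃ λ y → E (x , y) × x ≤ i × i ≤ y
Cell-∈ {S = x ∷ xs} c i∈ = x , lastOr x xs , Cell-bounds c , ∈⇒≥head (Cell.sorted c) i∈ , ∈⇒≤last (Cell.sorted c) i∈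

occ-paths-below : ∀ {k} (ts : Vec Tree k) l {i} → i < l → occ (path ts l ∷ forestCells ts l) i ≡ 0
occ-paths-below ts l i<l = occ-none (path ts l ∷ forestCells ts l) λ
  { (here refl) i∈ → <⇒≱ i<l (All.lookup (proj₁ (path-sorted ts l)) i∈)
  ; (there S∈) i∈ → let x , y , e , x≤i , i≤y = Cell-∈ (forestCells-sound ts l S∈) i∈
                     in <⇒≱ i<l (≤-trans (proj₁ (forestEdges-bounds ts l e)) x≤i) }

mutual
  -- Here `g` counts the corners after the tree. They lie at `treeEnd t l` or later, so counts may
  -- overlap at that vertex and are added.
  spells-word : ∀ t l {g s} → (∀ {i} → i < treeEnd t l → g i ≡ 0) → Spells g (treeEnd t l) s →
    Spells (λ i → occ (treeCells t l) i + g i) l (word t s)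
  spells-word leaf      l {g} {s} z sp = spells-side {g = g} {s = s} (z ≤-refl) (λ _ → refl) sp
  spells-word (node ts) l {s = s} z sp = spells-words ts l {s = s} z sp

  -- The part of the current cell from `l` on is counted as if it were a whole cell, so that each
  -- corner of the word removes one vertex from it.
  spells-words : ∀ {k} (ts : Vec Tree k) l {g s} → (∀ {i} → i < forestEnd ts l → g i ≡ 0) →
    Spells g (forestEnd ts l) s →
    Spells (λ i → occ (path ts l ∷ forestCells ts l) i + g i) l (words ts s)
  spells-words [] l {g} {s} z sp = spells-corner {g = g} {s = s}
    (cong (_+ g l) (occ-∈ (l ∷ []) [] (here refl)))
    (λ {i} l<i → cong (_+ g i) (occ-∉ {i} (l ∷ []) [] (λ { (here refl) → <-irrefl refl l<i })))
    sp
  spells-words (t ∷ ts) l {g} {s} z sp = spells-corner {f = f} {g = h} {s = word t (words ts s)}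
    (trans (cong (_+ g l) (trans (occ-∈ P (C ++ C′) (here refl)) (cong suc (trans (occ-++ C C′ l)
        (cong (occ C l +_) (sym (occ-∉ (path ts u) C′ λ l∈ → <⇒≱ (l<treeEnd t l) (All.lookup (proj₁ (path-sorted ts u)) l∈))))))))
      (+-assoc (suc (occ C l)) _ (g l)))
    (λ {i} l<i → trans (cong (_+ g i) (trans (occ-path∷ (path ts u) (C ++ C′) l<i)
        (trans (occ-++ (path ts u ∷ []) (C ++ C′) i)
          (trans (cong (occ (path ts u ∷ []) i +_) (occ-++ C C′ i))
            (trans (swap (occ (path ts u ∷ []) i) (occ C i) (occ C′ i))
              (cong (occ C i +_) (sym (occ-++ (path ts u ∷ []) C′ i))))))))
      (+-assoc (occ C i) _ (g i)))
    (spells-word t l {s = words ts s} (λ {i} i<u → cong₂ _+_ (occ-paths-below ts u i<u) (z (<-≤-trans i<u (l≤forestEnd ts u))))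
      (spells-words ts u {s = s} z sp))
    where
    u = treeEnd t l
    P = path (t ∷ ts) l
    C = treeCells t l
    C′ = forestCells ts u
    h f : ℕ → ℕ
    h i = occ C i + (occ (path ts u ∷ C′) i + g i)
    f i = occ (P ∷ C ++ C′) i + g i
    swap : ∀ a b c → a + (b + c) ≡ b + (a + c)
    swap = solve-∀

mutual
  sides-word : ∀ t l s → sides (word t s) + l ≡ sides s + treeEnd t l
  sides-word leaf      l s = sym (+-suc (sides s) l)
  sides-word (node ts) l s = sides-words ts l s

  sides-words : ∀ {k} (ts : Vec Tree k) l s → sides (words ts s) + l ≡ sides s + forestEnd ts l
  sides-words []       l s = refl
  sides-words (t ∷ ts) l s = trans (sides-word t l (words ts s)) (sides-words ts (treeEnd t l) s)

decode-word : ∀ t → decode (word t []) ≡ map (occ (treeCells t 0)) (upTo (suc (treeEnd t 0)))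
decode-word t = trans (spells-word t 0 {λ _ → 0} {[]} (λ _ → refl) refl)
  (trans (cong (table _ 0) (trans (sym (+-identityʳ _)) (sides-word t 0 [])))
    (trans (table-cong 0 (treeEnd t 0) (λ _ → +-identityʳ _)) (table-upTo _ _)))

-- Trees and sets of chords

mutual
  treeEdges-noncrossing : ∀ t l {a b c d} → (a , b) ∈ treeEdges t l → (c , d) ∈ treeEdges t l →
    a < c → c < b → b < d → ⊥
  treeEdges-noncrossing leaf l (here refl) (here refl) a<c _ _ = <-irrefl refl a<c
  treeEdges-noncrossing (node ts) l (here refl) q _ _ b<d = <⇒≱ b<d (proj₂ (proj₂ (treeEdges-bounds (node ts) l q)))
  treeEdges-noncrossing (node ts) l (there p) (here refl) a<c _ _ = <⇒≱ a<c (proj₁ (forestEdges-bounds ts l p))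
  treeEdges-noncrossing (node ts) l (there p) (there q) = forestEdges-noncrossing ts l p q

  forestEdges-noncrossing : ∀ {k} (ts : Vec Tree k) l {a b c d} → (a , b) ∈ forestEdges ts l →
    (c , d) ∈ forestEdges ts l → a < c → c < b → b < d → ⊥
  forestEdges-noncrossing (t ∷ ts) l p q a<c c<b b<d with ∈-++⁻ (treeEdges t l) p | ∈-++⁻ (treeEdges t l) q
  ... | inj₁ p′ | inj₁ q′ = treeEdges-noncrossing t l p′ q′ a<c c<b b<d
  ... | inj₁ p′ | inj₂ q′ = <⇒≱ c<b (≤-trans (proj₂ (proj₂ (treeEdges-bounds t l p′))) (proj₁ (forestEdges-bounds ts _ q′)))
  ... | inj₂ p′ | inj₁ q′ = <⇒≱ (<-trans a<c (<-trans c<b b<d))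
         (≤-trans (proj₂ (proj₂ (treeEdges-bounds t l q′))) (proj₁ (forestEdges-bounds ts _ p′)))
  ... | inj₂ p′ | inj₂ q′ = forestEdges-noncrossing ts _ p′ q′ a<c c<b b<d

mutual
  side∈treeEdges : ∀ t l {i} → l ≤ i → i < treeEnd t l → (i , suc i) ∈ treeEdges t l
  side∈treeEdges leaf l l≤i i<e with refl ← ≤-antisym l≤i (≤-pred i<e) = here refl
  side∈treeEdges (node ts) l l≤i i<e = there (side∈forestEdges ts l l≤i i<e)

  side∈forestEdges : ∀ {k} (ts : Vec Tree k) l {i} → l ≤ i → i < forestEnd ts l →
    (i , suc i) ∈ forestEdges ts l
  side∈forestEdges []       l l≤i i<e = contradiction l≤i (<⇒≱ i<e)
  side∈forestEdges (t ∷ ts) l {i} l≤i i<e with i <? treeEnd t l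
  ... | yes i<u = ∈-++⁺ˡ (side∈treeEdges t l l≤i i<u)
  ... | no  i≮u = ∈-++⁺ʳ (treeEdges t l) (side∈forestEdges ts _ (≮⇒≥ i≮u) i<e)

greatest : {P : ℕ → Set} → Decidable P → ∀ n {a} → P a → a < n →
  ∃ λ u → a ≤ u × u < n × P u × (∀ {j} → u < j → j < n → ¬ P j)
greatest P? (suc n) {a} pa (s≤s a≤n) with P? n
... | yes pn = n , a≤n , ≤-refl , pn , λ n<j j≤n → contradiction n<j (≤⇒≯ (≤-pred j≤n))
... | no ¬pn with m≤n⇒m<n∨m≡n a≤n
...   | inj₂ refl = contradiction pa ¬pn
...   | inj₁ a<n with u , a≤u , u<n , pu , max ← greatest P? n pa a<n =
  u , a≤u , <-trans u<n ≤-refl , pu , λ {j} u<j j≤n pj → [ (λ j<n → max u<j j<n pj) , (λ { refl → ¬pn pj }) ]′ (m≤n⇒m<n∨m≡n (≤-pred j≤n))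

module _ (N : ℕ) (E : ℕ → ℕ → Set) (E? : ∀ i → Decidable (E i)) (E-side : ∀ i → E i (suc i))
  (E-noncrossing : ∀ {a b c d} → a < c → c < b → b < d → d < N → E a b → E c d → ⊥) where

  private
    Covers : List Chord → ℕ → ℕ → Set
    Covers L l r = (∀ {i j} → (i , j) ∈ L → E i j) ×
      (∀ {i j} → l ≤ i → i < j → j ≤ r → E i j → (i , j) ∈ L)

    -- The pair `(l , r)` is left open: no forest of two or more trees contains it, and `build`
    -- treats it separately.
    CoversBut : List Chord → ℕ → ℕ → Set
    CoversBut L l r = (∀ {i j} → (i , j) ∈ L → E i j) ×
      (∀ {i j} → l ≤ i → i < j → j ≤ r → ¬ (i ≡ l × j ≡ r) → E i j → (i , j) ∈ L)

    TreeOn ForestOn : ℕ → ℕ → Set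
    TreeOn l r = ∃ λ t → treeEnd t l ≡ r × Covers (treeEdges t l) l r
    ForestOn l r = ∃ λ k → Σ (Vec Tree (suc k)) λ ts → forestEnd ts l ≡ r × Covers (forestEdges ts l) l r

    single : ∀ {l r} → TreeOn l r → ForestOn l r
    single {l} (t , e , s , c) = 0 , t ∷ [] , e ,
      (λ p → [ s , (λ ()) ]′ (∈-++⁻ (treeEdges t l) p)) , λ a b d x → ∈-++⁺ˡ (c a b d x)

    -- An edge straddling `u` crosses `(l , u)` if it starts after `l`. If it starts at `l` and ends
    -- before `r`, it contradicts the choice of `u` as the farthest neighbour. The only other
    -- possibility is the excluded pair `(l , r)`.
    glue : ∀ {l u r} → l < u → u < r → r < N → E l u → (∀ {j} → u < j → j < r → ¬ E l j) →
      TreeOn l u → ForestOn u r → ∃ λ k → Σ (Vec Tree (2 + k)) λ ts → forestEnd ts l ≡ r × CoversBut (forestEdges ts l) l r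
    glue {l} {u} {r} l<u u<r r<N lu max (t , refl , s , c) (k , ts , e , s′ , c′) = k , t ∷ ts , e ,
      (λ p → [ s , s′ ]′ (∈-++⁻ (treeEdges t l) p)) , complete
      where
      complete : ∀ {i j} → l ≤ i → i < j → j ≤ r → ¬ (i ≡ l × j ≡ r) → E i j →
        (i , j) ∈ treeEdges t l ++ forestEdges ts (treeEnd t l)
      complete {i} {j} l≤i i<j j≤r notRoot ij with j ≤? u | u ≤? i
      ... | yes j≤u | _ = ∈-++⁺ˡ (c l≤i i<j j≤u ij)
      ... | _ | yes u≤i = ∈-++⁺ʳ (treeEdges t l) (c′ u≤i i<j j≤r ij)
      ... | no j≰u | no u≰i with m≤n⇒m<n∨m≡n l≤i
      ...   | inj₁ l<i = ⊥-elim (E-noncrossing l<i (≰⇒> u≰i) (≰⇒> j≰u) (≤-<-trans j≤r r<N) lu ij)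
      ...   | inj₂ refl with m≤n⇒m<n∨m≡n j≤r
      ...     | inj₁ j<r = contradiction ij (max (≰⇒> j≰u) j<r)
      ...     | inj₂ refl = contradiction (refl , refl) notRoot

    short : ∀ {l i j} → l ≤ i → i < j → j ≤ suc l → i ≡ l × j ≡ suc l
    short l≤i i<j j≤ with refl ← ≤-antisym l≤i (≤-pred (≤-trans i<j j≤)) = refl , ≤-antisym j≤ i<j

    leafOn : ∀ l → TreeOn l (suc l)
    leafOn l = leaf , refl , (λ { (here refl) → E-side l }) ,
      λ a b c _ → here (let p , q = short a b c in cong₂ _,_ p q)

    -- The cell under (l , r) is found greedily: its next vertex is the farthest
    -- neighbour u < r of l, and no chord crosses (l , u).
    build : ∀ k l r → l < r → r ≤ k + l → r < N → (E l r → TreeOn l r) × ForestOn l r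
    -- The first argument bounds the width r - l, which is smaller for both `(l , u)` and `(u , r)`.
    build zero    l r l<r r≤l = contradiction r≤l (<⇒≱ l<r)
    build (suc k) l r l<r r≤ r<N with m≤n⇒m<n∨m≡n l<r
    ... | inj₂ refl = (λ _ → leafOn l) , single (leafOn l)
    ... | inj₁ l+1<r with u , l<u , u<r , lu , max ← greatest (E? l) r (E-side l) l+1<r
      with k′ , ts , e , s , c ← glue l<u u<r r<N lu max
        (proj₁ (build k l u l<u (≤-pred (≤-trans u<r r≤)) (<-trans u<r r<N)) lu)
        (proj₂ (build k u r u<r (≤-trans r≤ (≤-trans (≤-reflexive (sym (+-suc k l))) (+-monoʳ-≤ k l<u))) r<N))
      -- If `(l , r)` is an edge, the trees found become the children of a node under it. Otherwise
      -- they stay a forest and are completed to a cell by a caller.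
      with E? l r
    ... | yes lr = (λ _ → whole) , single whole
      where
      whole : TreeOn l r
      whole = node ts , e , (λ { (here refl) → subst (E l) (sym e) lr ; (there p) → s p }) , covers
        where
        covers : ∀ {i j} → l ≤ i → i < j → j ≤ r → E i j → (i , j) ∈ treeEdges (node ts) l
        covers {i} {j} a b d x with i ≟ l | j ≟ r
        ... | yes refl | yes refl = here (cong (i ,_) (sym e))
        ... | no ¬p | _ = there (c a b d (¬p ∘ proj₁) x)
        ... | _ | no ¬p = there (c a b d (¬p ∘ proj₂) x)
    ... | no ¬lr = (λ lr → contradiction lr ¬lr) ,
      suc k′ , ts , e , s , λ a b d x → c a b d (λ { (refl , refl) → ¬lr x }) x

  tree-of-chords : ∀ r → 0 < r → r < N → E 0 r → ∃ λ t → treeEnd t 0 ≡ r ×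
    (∀ {i j} → (i , j) ∈ treeEdges t 0 → E i j) × (∀ {i j} → i < j → j ≤ r → E i j → (i , j) ∈ treeEdges t 0)
  tree-of-chords r 0<r r<N 0r with t , e , s , c ← proj₁ (build r 0 r 0<r (m≤m+n r 0) r<N) 0r = t , e , s , c z≤n

-- Counting reduced trees

length-cartesianProduct : {A B : Set} (xs : List A) (ys : List B) →
  length (cartesianProduct xs ys) ≡ length xs * length ys
length-cartesianProduct []       ys = refl
length-cartesianProduct (x ∷ xs) ys = trans (length-++ (map (x ,_) ys))
  (cong₂ _+_ (length-map (x ,_) ys) (length-cartesianProduct xs ys))

-- Series identities turn into operations on such enumerations: a sum is a disjoint union, and a
-- product of series is a pair of objects with given total size.
record Counted {A : Set} (P : A → Set) (c : ℕ) : Set where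
  constructor counted
  field
    elements : List A
    unique   : Unique elements
    sound    : ∀ {a} → a ∈ elements → P a
    complete : ∀ {a} → P a → a ∈ elements
    size-is  : length elements ≡ c

map-unique : {A B : Set} (f : A → B) {xs : List A} →
  (∀ {x y} → x ∈ xs → y ∈ xs → f x ≡ f y → x ≡ y) → Unique xs → Unique (map f xs)
map-unique f {[]}     inj [] = []
map-unique f {x ∷ xs} inj (x∉ ∷ u) =
  All.map⁺ (All.tabulate λ y∈ eq → All.lookup x∉ y∈ (inj (here refl) (there y∈) eq))
  ∷ map-unique f (λ p q → inj (there p) (there q)) u

counted-map : {A B : Set} {P : A → Set} {R : B → Set} {c : ℕ} (f : A → B) →
  (∀ {x y} → P x → P y → f x ≡ f y → x ≡ y) → (∀ {x} → P x → R (f x)) →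
  (∀ {y} → R y → ∃ λ x → P x × f x ≡ y) → Counted P c → Counted R c
counted-map {R = R} f inj P⇒R onto (counted L u s c n) = counted (map f L)
  (map-unique f (λ p q → inj (s p) (s q)) u)
  (λ y∈ → let x , x∈ , y≡ = ∈-map⁻ f y∈ in subst R (sym y≡) (P⇒R (s x∈)))
  (λ r → let x , p , fx≡y = onto r in subst (_∈ map f L) fx≡y (∈-map⁺ f (c p)))
  (trans (length-map f L) n)

counted-⇔ : {A : Set} {P R : A → Set} {c : ℕ} →
  (∀ {x} → P x → R x) → (∀ {x} → R x → P x) → Counted P c → Counted R c
counted-⇔ to from (counted L u s c n) = counted L u (to ∘ s) (c ∘ from) n

counted-∅ : {A : Set} {P : A → Set} → (∀ {x} → ¬ P x) → Counted P 0
counted-∅ none = counted [] [] (λ ()) (λ p → ⊥-elim (none p)) refl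

counted-× : {A B : Set} {P : A → Set} {R : B → Set} {m n : ℕ} → Counted P m → Counted R n →
  Counted (λ (x : A × B) → P (proj₁ x) × R (proj₂ x)) (m * n)
counted-× (counted L u s c n) (counted L′ u′ s′ c′ n′) = counted (cartesianProduct L L′)
  (Unique.cartesianProduct⁺ u u′)
  (λ p → let q , q′ = ∈-cartesianProduct⁻ L L′ p in s q , s′ q′)
  (λ (p , p′) → ∈-cartesianProduct⁺ (c p) (c′ p′))
  (trans (length-cartesianProduct L L′) (cong₂ _*_ n n′))

counted-⊎ : {A : Set} {P R : A → Set} {m n : ℕ} → (∀ {x} → P x → R x → ⊥) →
  Counted P m → Counted R n → Counted (λ x → P x ⊎ R x) (m + n)
counted-⊎ {P = P} {R} disj (counted L u s c n) (counted L′ u′ s′ c′ n′) = counted (L ++ L′)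
  (Unique.++⁺ u u′ (λ (p , q) → disj (s p) (s′ q)))
  snd
  (λ { (inj₁ p) → ∈-++⁺ˡ (c p) ; (inj₂ p) → ∈-++⁺ʳ L (c′ p) })
  (trans (length-++ L) (cong₂ _+_ n n′))
  where
  snd : ∀ {a} → a ∈ L ++ L′ → P a ⊎ R a
  snd p with ∈-++⁻ L p
  ... | inj₁ q = inj₁ (s q)
  ... | inj₂ q = inj₂ (s′ q)

counted-Σ : {B : ℕ → Set} {P : ∀ k → B k → Set} {h : ℕ → ℕ} (ks : List ℕ) → Unique ks →
  (∀ {k} → k ∈ ks → Counted (P k) (h k)) →
  Counted (λ (x : Σ ℕ B) → proj₁ x ∈ ks × P (proj₁ x) (proj₂ x)) (sum (map h ks))
counted-Σ [] [] cs = counted-∅ λ { (() , _) }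
counted-Σ {P = P} (k ∷ ks) (k∉ ∷ u) cs = counted-⇔
  (λ { (inj₁ (refl , p)) → here refl , p ; (inj₂ (k∈ , p)) → there k∈ , p })
  (λ { (here refl , p) → inj₁ (refl , p) ; (there k∈ , p) → inj₂ (k∈ , p) })
  (counted-⊎ (λ { (refl , _) (k∈ , _) → All.lookup k∉ k∈ refl })
    (counted-map {R = λ x → proj₁ x ≡ k × P (proj₁ x) (proj₂ x)} (k ,_)
      (λ { _ _ refl → refl }) (refl ,_) (λ { {_ , b} (refl , p) → b , p , refl }) (cs (here refl)))
    (counted-Σ ks u (cs ∘ there)))

-- The size of the first component is carried along as an index, which makes the union over it
-- disjoint, and is then forgotten by `proj₂`. Only sizes up to `n` are assumed counted, as the
-- recursion for P requires.
counted-⊛ : {A B : Set} {sA : A → ℕ} {sB : B → ℕ} {f g : Series} (n : ℕ) →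
  (∀ {i} → i ≤ n → Counted (λ a → sA a ≡ i) (f i)) →
  (∀ {i} → i ≤ n → Counted (λ b → sB b ≡ i) (g i)) →
  Counted (λ (x : A × B) → sA (proj₁ x) + sB (proj₂ x) ≡ n) ((f ⊛ g) n)
counted-⊛ {sA = sA} {sB} n cA cB = counted-map proj₂
  (λ { {k , _} {k′ , _} (_ , refl , _) (_ , refl , _) refl → refl })
  (λ { (k∈ , refl , eq) → trans (cong (_ +_) eq) (m+[n∸m]≡n (≤-pred (∈-upTo⁻ k∈))) })
  (λ { {a , b} refl → (sA a , a , b) ,
       (∈-upTo⁺ (s≤s (m≤m+n _ _)) , refl , sym (m+n∸m≡n (sA a) (sB b))) , refl })
  (counted-Σ (upTo (suc n)) (Unique.upTo⁺ (suc n))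
    (λ {k} k∈ → counted-× (cA (≤-pred (∈-upTo⁻ k∈))) (cB (m∸n≤m n k))))

counted-one : ∀ n → Counted (λ (v : Vec Reduced 0) → sizes v ≡ n) (one n)
counted-one zero    = counted ([] ∷ []) ([] ∷ []) (λ { (here refl) → refl }) (λ { {[]} _ → here refl }) refl
counted-one (suc n) = counted-∅ λ { {[]} () }

counted-^ : {f : Series} (m n : ℕ) → (∀ {i} → i ≤ n → Counted (λ r → size r ≡ i) (f i)) →
  Counted (λ (v : Vec Reduced m) → sizes v ≡ n) ((f ^ˢ m) n)
counted-^ zero    n c = counted-one n
counted-^ (suc m) n c = counted-map (λ (r , v) → r ∷ v)
  (λ { _ _ refl → refl }) (λ p → p) (λ { {r ∷ v} p → (r , v) , p , refl })
  (counted-⊛ n c (λ i≤n → counted-^ m _ (λ j≤i → c (≤-trans j≤i i≤n))))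

counted-shift : {A : Set} {s : A → ℕ} {f : Series} (m n : ℕ) →
  (m ≤ n → Counted (λ a → s a ≡ n ∸ m) (f (n ∸ m))) →
  Counted (λ a → m + s a ≡ n) (shift m f n)
counted-shift m n c with m ≤ᵇ n in eq
... | true  = counted-⇔ (λ p → trans (cong (m +_) p) (m+[n∸m]≡n m≤n))
                        (λ { refl → sym (m+n∸m≡n m _) }) (c m≤n)
  where m≤n = ≤ᵇ⇒≤ m n (subst Data.Bool.T (sym eq) tt)
... | false = counted-∅ λ { refl → subst Data.Bool.T eq (≤⇒≤ᵇ (m≤m+n m _)) }

-- The cell itself accounts for 3k+1 ≥ 1, so its free children all have size below `n`; this makes
-- the recursion for P well founded.
counted-sumZ3 : {f : Series} (e : ℕ → ℕ) (n : ℕ) → (∀ {i} → i < n → Counted (λ r → size r ≡ i) (f i)) →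
  Counted (λ (x : Σ ℕ λ k → Vec Reduced (e k)) → 3 * proj₁ x + 1 + sizes (proj₂ x) ≡ n)
    (sumZ3 (λ k → f ^ˢ e k) n)
counted-sumZ3 e n c = counted-⇔ proj₂
  -- Since k ≤ 3k+1 ≤ n, cutting the sum off at k = n loses no cell.
  (λ { {k , v} refl → ∈-upTo⁺ (s≤s (≤-trans (m≤n*m k 3) (≤-trans (m≤m+n _ 1) (m≤m+n _ _)))) , refl })
  (counted-Σ (upTo (suc n)) (Unique.upTo⁺ (suc n)) λ {k} _ → counted-shift (3 * k + 1) n
    λ le → counted-^ (e k) _ λ i≤ → c (≤-<-trans i≤ (smaller k le)))
  where
  smaller : ∀ k → 3 * k + 1 ≤ n → n ∸ (3 * k + 1) < n
  smaller k le = ≤-trans (≤-reflexive (trans (cong suc (cong (n ∸_) (+-comm (3 * k) 1))) refl))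
    (∸-monoʳ-< {n} {suc (3 * k)} {0} (s≤s z≤n) (≤-trans (≤-reflexive (+-comm 1 (3 * k))) le))

sumZ3-cong : (f : Series) {e e′ : ℕ → ℕ} → (∀ k → e k ≡ e′ k) →
  ∀ n → sumZ3 (λ k → f ^ˢ e k) n ≡ sumZ3 (λ k → f ^ˢ e′ k) n
sumZ3-cong f eq n = cong sum (map-cong (λ k → cong (λ m → shift (3 * k + 1) (f ^ˢ m) n) (eq k)) (upTo (suc n)))

-- Strong induction on the size. The leaf is the term 1, and the nodes with parameter k, having 2k+2
-- free children, are the term z^(3k+1) P^(2k+2).
counted-reduced : {P : Series} → (∀ n → P n ≡ Prhs P n) → ∀ n → Counted (λ r → size r ≡ n) (P n)
counted-reduced {P} rec = <-rec _ step
  where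
  even : ∀ k → 2 * k + 2 ≡ suc k * 2
  even = solve-∀

  leaves : ∀ n → Counted (λ r → r ≡ leaf × 0 ≡ n) (one n)
  leaves zero    = counted (leaf ∷ []) ([] ∷ [])
    (λ { (here refl) → refl , refl }) (λ { (refl , _) → here refl }) refl
  leaves (suc n) = counted-∅ λ ()

  step : ∀ n → (∀ {i} → i < n → Counted (λ r → size r ≡ i) (P i)) → Counted (λ r → size r ≡ n) (P n)
  step n ih rewrite rec n | sumZ3-cong P even n = counted-⇔
    (λ { (inj₁ (refl , refl)) → refl ; (inj₂ (_ , p)) → p })
    (λ { {leaf} p → inj₁ (refl , p) ; {node k v} p → inj₂ ((λ ()) , p) })
    (counted-⊎ {P = λ r → r ≡ leaf × 0 ≡ n} {R = λ r → r ≢ leaf × size r ≡ n}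
      (λ { (refl , _) (ne , _) → ne refl })
      (leaves n)
      (counted-map (λ (k , v) → node k v) (λ { _ _ refl → refl }) (λ p → (λ ()) , p)
        (λ { {leaf} (ne , _) → contradiction refl ne ; {node k v} (_ , p) → (k , v) , p , refl })
        (counted-sumZ3 (λ k → suc k * 2) n ih)))

-- All 3k+2 children of the root cell are free, whence the exponent 3k+2 of P. The summand `one`
-- vanishes in positive degree.
counted-roots : {P : Series} → (∀ n → P n ≡ Prhs P n) → ∀ n →
  Counted (λ (x : Σ ℕ λ k → Vec Reduced (2 + k * 3)) → 3 * proj₁ x + 1 + sizes (proj₂ x) ≡ suc n) (Qrhs P (suc n))
counted-roots {P} rec n rewrite sumZ3-cong P (λ k → trans (+-comm (3 * k) 2) (cong (2 +_) (*-comm 3 k))) (suc n) =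
  counted-sumZ3 (λ k → 2 + k * 3) (suc n) (λ _ → counted-reduced rec _)

unique-↭ : {A : Set} {xs ys : List A} → Unique xs → Unique ys →
  (∀ {a} → a ∈ xs → a ∈ ys) → (∀ {a} → a ∈ ys → a ∈ xs) → xs ↭ ys
unique-↭ u u′ f g = ∼bag⇒↭ (unique∧set⇒bag u u′ (mk⇔ f g))

-- Trees and dissections

sublists-⊆ : {A : Set} (xs : List A) {ys : List A} → ys ∈ sublists xs → ∀ {y} → y ∈ ys → y ∈ xs
sublists-⊆ [] (here refl) ()
sublists-⊆ (x ∷ xs) p y∈ with ∈-++⁻ (map (x ∷_) (sublists xs)) p
... | inj₂ q = there (sublists-⊆ xs q y∈)
... | inj₁ q with _ , q′ , refl ← ∈-map⁻ (x ∷_) q with y∈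
...   | here refl = here refl
...   | there y∈′ = there (sublists-⊆ xs q′ y∈′)

sublists-AllPairs : {A : Set} {R : A → A → Set} (xs : List A) {ys : List A} → AllPairs R xs →
  ys ∈ sublists xs → AllPairs R ys
sublists-AllPairs [] _ (here refl) = []
sublists-AllPairs (x ∷ xs) (Rx ∷ R) p with ∈-++⁻ (map (x ∷_) (sublists xs)) p
... | inj₂ q = sublists-AllPairs xs R q
... | inj₁ q with _ , q′ , refl ← ∈-map⁻ (x ∷_) q =
  All.tabulate (λ y∈ → All.lookup Rx (sublists-⊆ xs q′ y∈)) ∷ sublists-AllPairs xs R q′

[]∈sublists : {A : Set} (xs : List A) → [] ∈ sublists xs
[]∈sublists []       = here refl
[]∈sublists (x ∷ xs) = ∈-++⁺ʳ (map (x ∷_) (sublists xs)) ([]∈sublists xs)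

sorted∈sublists : ∀ xs ys → AllPairs _<_ xs → AllPairs _<_ ys → (∀ {y} → y ∈ ys → y ∈ xs) → ys ∈ sublists xs
sorted∈sublists xs       []       _ _ _ = []∈sublists xs
sorted∈sublists []       (y ∷ ys) _ _ sub with () ← sub (here refl)
sorted∈sublists (x ∷ xs) (y ∷ ys) (x< ∷ so) (y< ∷ so′) sub with sub (here refl)
... | here refl = ∈-++⁺ˡ (∈-map⁺ (x ∷_) (sorted∈sublists xs ys so so′ sub′))
  where
  sub′ : ∀ {z} → z ∈ ys → z ∈ xs
  sub′ z∈ with sub (there z∈)
  ... | here refl = contradiction (All.lookup y< z∈) (<-irrefl refl)
  ... | there q   = q
... | there y∈ = ∈-++⁺ʳ (map (x ∷_) (sublists xs)) (sorted∈sublists xs (y ∷ ys) so (y< ∷ so′) sub′)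
  where
  sub′ : ∀ {z} → z ∈ y ∷ ys → z ∈ xs
  sub′ (here refl) = y∈
  sub′ (there z∈) with sub (there z∈)
  ... | here refl = contradiction (All.lookup y< z∈) (<⇒≯ (All.lookup x< y∈))
  ... | there q   = q

sublists-unique : {A : Set} (xs : List A) → Unique xs → Unique (sublists xs)
sublists-unique []       _        = [] ∷ []
sublists-unique (x ∷ xs) (x∉ ∷ u) = Unique.++⁺
  (Unique.map⁺ (proj₂ ∘ ∷-injective) (sublists-unique xs u)) (sublists-unique xs u)
  λ (p , q) → disjoint p q
  where
  disjoint : ∀ {ys} → ys ∈ map (x ∷_) (sublists xs) → ys ∈ sublists xs → ⊥
  disjoint p q with _ , _ , refl ← ∈-map⁻ (x ∷_) p = All.lookup x∉ (sublists-⊆ xs q (here refl)) refl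

filter∈sublists : {A : Set} (p : A → Bool) (xs : List A) → filterᵇ p xs ∈ sublists xs
filter∈sublists p []       = here refl
filter∈sublists p (x ∷ xs) with p x
... | true  = ∈-++⁺ˡ (∈-map⁺ (x ∷_) (filter∈sublists p xs))
... | false = ∈-++⁺ʳ (map (x ∷_) (sublists xs)) (filter∈sublists p xs)

upTo-sorted : ∀ n → AllPairs _<_ (upTo n)
upTo-sorted n = AllPairs.applyUpTo⁺₁ id n λ i<j _ → i<j

-- The Boolean tests and their meaning

mem⇒∈ : ∀ D {c} → T (mem D c) → c ∈ D
mem⇒∈ D {a , b} p = Any.map (λ {(c , d)} q → let q₁ , q₂ = to (T-∧ {a ≡ᵇ c}) q in
  cong₂ _,_ (≡ᵇ⇒≡ a c q₁) (≡ᵇ⇒≡ b d q₂)) (Any.any⁻ (chordEq (a , b)) D p)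

∈⇒mem : ∀ {D c} → c ∈ D → T (mem D c)
∈⇒mem {D} {a , b} p = Any.any⁺ (chordEq (a , b)) (Any.map (λ { refl → from T-∧ (≡⇒≡ᵇ a a refl , ≡⇒≡ᵇ b b refl) }) p)

T-not⁺ : ∀ {b} → ¬ T b → T (not b)
T-not⁺ {true}  ¬t = ¬t tt
T-not⁺ {false} _  = tt

T-not⁻ : ∀ {b} → T (not b) → ¬ T b
T-not⁻ {true} ()
T-not⁻ {false} _ ()

isSide⁻ : ∀ N i j → T (isSide N (i , j)) → j ≡ suc i ⊎ (i ≡ 0 × suc j ≡ N)
isSide⁻ N i j p with to (T-∨ {j ≡ᵇ suc i}) p
... | inj₁ q = inj₁ (≡ᵇ⇒≡ j (suc i) q)
... | inj₂ q = let q₁ , q₂ = to (T-∧ {i ≡ᵇ 0}) q in inj₂ (≡ᵇ⇒≡ i 0 q₁ , ≡ᵇ⇒≡ (suc j) N q₂)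

isSide⁺ : ∀ N i j → j ≡ suc i ⊎ (i ≡ 0 × suc j ≡ N) → T (isSide N (i , j))
isSide⁺ N i j (inj₁ eq)         = from (T-∨ {j ≡ᵇ suc i}) (inj₁ (≡⇒≡ᵇ j (suc i) eq))
isSide⁺ N i j (inj₂ (eq , eq′)) = from (T-∨ {j ≡ᵇ suc i}) (inj₂ (from T-∧ (≡⇒≡ᵇ i 0 eq , ≡⇒≡ᵇ (suc j) N eq′)))

∈-diagonals⁺ : ∀ N {i j} → i < j → j < N → ¬ T (isSide N (i , j)) → (i , j) ∈ diagonals N
∈-diagonals⁺ N i<j j<N ns = ∈-filter⁺ (T? ∘ λ c → not (isSide N c))
  (∈-filter⁺ (T? ∘ λ { (i , j) → i <ᵇ j }) (∈-cartesianProduct⁺ (∈-upTo⁺ (<-trans i<j j<N)) (∈-upTo⁺ j<N)) (<⇒<ᵇ i<j))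
  (T-not⁺ ns)

crosses⁺ : ∀ {a b c d} → a < c → c < b → b < d → T (crosses (a , b) (c , d))
crosses⁺ p q r = from T-∨ (inj₁ (from T-∧ (<⇒<ᵇ p , from T-∧ (<⇒<ᵇ q , <⇒<ᵇ r))))

crosses⁻ : ∀ a b c d → T (crosses (a , b) (c , d)) → (a < c × c < b × b < d) ⊎ (c < a × a < d × d < b)
crosses⁻ a b c d p with to (T-∨ {(a <ᵇ c) ∧ (c <ᵇ b) ∧ (b <ᵇ d)}) p
... | inj₁ q = let x , q′ = to (T-∧ {a <ᵇ c}) q ; y , z = to (T-∧ {c <ᵇ b}) q′ in
  inj₁ (<ᵇ⇒< a c x , <ᵇ⇒< c b y , <ᵇ⇒< b d z)
... | inj₂ q = let x , q′ = to (T-∧ {c <ᵇ a}) q ; y , z = to (T-∧ {a <ᵇ d}) q′ in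
  inj₂ (<ᵇ⇒< c a x , <ᵇ⇒< a d y , <ᵇ⇒< d b z)

nonCrossing⁻ : ∀ D → T (nonCrossing D) → ∀ {c d} → c ∈ D → d ∈ D → ¬ T (crosses c d)
nonCrossing⁻ D nc c∈ d∈ = T-not⁻ (All.lookup (All.all⁺ _ D (All.lookup (All.all⁺ _ D nc) c∈)) d∈)

nonCrossing⁺ : ∀ D → (∀ {c d} → c ∈ D → d ∈ D → ¬ T (crosses c d)) → T (nonCrossing D)
nonCrossing⁺ D nc = All.all⁻ _ (All.tabulate λ c∈ → All.all⁻ _ (All.tabulate λ d∈ → T-not⁺ (nc c∈ d∈)))

suc-adj : ∀ {xs} → AllPairs _<_ xs → ∀ {i} → (i , suc i) ∈ allPairs xs → (i , suc i) ∈ adjPairs xs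
suc-adj {x ∷ []} so ()
suc-adj {x ∷ y ∷ xs} (x< ∷ so) p with allPairs⁻ x (y ∷ xs) p
... | inj₂ q = there (suc-adj so q)
... | inj₁ (refl , here refl) = here refl
... | inj₁ (refl , there j∈) = contradiction (All.lookup x< (here refl)) (≤⇒≯ (≤-pred (All.lookup (AllPairs.head so) j∈)))

Bounded : ℕ → List ℕ → Set
Bounded N S = AllPairs _<_ S × All (_< N) S

-- `isCell` excludes only chords of `D` between non-consecutive vertices. Sides are harmless:
-- `(i , suc i)` is consecutive in any sorted list, and 0 and N-1 can only be the first and last
-- vertex.
isCell⇒Cell : ∀ N D S → Bounded N S → T (isCell N D S) → Cell (T ∘ isEdge N D) S
isCell⇒Cell N D S (so , bd) p = mkCell so (≤ᵇ⇒≤ 3 (length S) p₁)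
  (All.lookup (All.all⁺ (isEdge N D) (cyclicPairs S) p₂))
  (λ {(i , j)} q e → go q (to (T-∨ {isSide N (i , j)}) e))
  where
  p₁ = proj₁ (to (T-∧ {3 ≤ᵇ length S}) p)
  p₂₃ = to (T-∧ {all (isEdge N D) (cyclicPairs S)}) (proj₂ (to (T-∧ {3 ≤ᵇ length S}) p))
  p₂ = proj₁ p₂₃
  p₃ = All.all⁺ (λ c → mem (cyclicPairs S) c ∨ not (mem D c)) (allPairs S) (proj₂ p₂₃)
  side⇒cyclic : ∀ S → Bounded N S → ∀ {i j} → (i , j) ∈ allPairs S →
    j ≡ suc i ⊎ (i ≡ 0 × suc j ≡ N) → (i , j) ∈ cyclicPairs S
  side⇒cyclic (x ∷ xs) (so , bd) q (inj₁ refl) = there (suc-adj so q)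
  side⇒cyclic (x ∷ xs) (so , bd) q (inj₂ (refl , refl)) = let i∈ , j∈ = allPairs-∈ (x ∷ xs) q in
    here (cong₂ _,_ (sym (n≤0⇒n≡0 (∈⇒≥head so i∈))) (≤-antisym (∈⇒≤last so j∈) (≤-pred (All.lookup bd (lastOr-∈ x xs)))))
  go : ∀ {i j} → (i , j) ∈ allPairs S → T (isSide N (i , j)) ⊎ T (mem D (i , j)) → (i , j) ∈ cyclicPairs S
  go {i} {j} q (inj₁ s) = side⇒cyclic S (so , bd) q (isSide⁻ N i j s)
  go {i} {j} q (inj₂ m) with to (T-∨ {mem (cyclicPairs S) (i , j)}) (All.lookup p₃ q)
  ... | inj₁ r = mem⇒∈ (cyclicPairs S) r
  ... | inj₂ r = contradiction m (T-not⁻ r)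

Cell⇒isCell : ∀ N D S → Cell (T ∘ isEdge N D) S → T (isCell N D S)
Cell⇒isCell N D S (mkCell so lo cl em) = from T-∧ (≤⇒≤ᵇ lo , from T-∧
  ( All.all⁻ (isEdge N D) (All.tabulate cl)
  , All.all⁻ (λ c → mem (cyclicPairs S) c ∨ not (mem D c)) (All.tabulate λ {(i , j)} → go)))
  where
  go : ∀ {i j} → (i , j) ∈ allPairs S → T (mem (cyclicPairs S) (i , j) ∨ not (mem D (i , j)))
  go {i} {j} q with T? (mem D (i , j))
  ... | yes m = from (T-∨ {mem (cyclicPairs S) (i , j)}) (inj₁ (∈⇒mem (em q (from (T-∨ {isSide N (i , j)}) (inj₂ m)))))
  ... | no ¬m = from (T-∨ {mem (cyclicPairs S) (i , j)}) (inj₂ (T-not⁺ ¬m))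

-- Trees representing dissections

-- The edges of the tree are the chords of `D` together with all sides, and `(0 , N-1)` is the root
-- edge. The bound `j < N` matters because `isSide` accepts `(i , suc i)` for every `i`.
record Represents (N : ℕ) (D : List Chord) (t : Tree) : Set where
  field
    end-is : suc (treeEnd t 0) ≡ N
    edge⇒  : ∀ {i j} → i < j → j < N → T (isEdge N D (i , j)) → (i , j) ∈ treeEdges t 0
    edge⇐  : ∀ {i j} → (i , j) ∈ treeEdges t 0 → T (isEdge N D (i , j))

module _ {N D t} (rep : Represents N D t) where
  open Represents rep

  cells↭ : cells N D ↭ treeCells t 0
  cells↭ = unique-↭ (Unique.filter⁺ _ (sublists-unique _ (Unique.upTo⁺ N))) (treeCells-unique t 0) fwd bwd
    where
    to-edges : ∀ {S} → Bounded N S → Cell (T ∘ isEdge N D) S → Cell (_∈ treeEdges t 0) S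
    to-edges {[]}     _         (mkCell _ () _ _)
    to-edges {x ∷ xs} (_ , bd) = Cell-local
      (λ _ i<j j≤ → edge⇒ i<j (≤-<-trans j≤ (All.lookup bd (lastOr-∈ x xs)))) (λ _ _ _ → edge⇐)

    from-edges : ∀ {S} → Cell (_∈ treeEdges t 0) S → Bounded N S × Cell (T ∘ isEdge N D) S
    from-edges {[]}     (mkCell _ () _ _)
    from-edges {x ∷ xs} c =
      (Cell.sorted c , All.tabulate λ i∈ → ≤-<-trans (∈⇒≤last (Cell.sorted c) i∈) last<) ,
      Cell-local (λ _ _ _ → edge⇐) (λ _ i<j j≤ → edge⇒ i<j (≤-<-trans j≤ last<)) c
      where
      last< : lastOr x xs < N
      last< = ≤-trans (s≤s (proj₂ (proj₂ (treeEdges-bounds t 0 (Cell-bounds c))))) (≤-reflexive end-is)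

    fwd : ∀ {S} → S ∈ cells N D → S ∈ treeCells t 0
    fwd {S} S∈ =
      let sub , ic = ∈-filter⁻ (T? ∘ isCell N D) {xs = sublists (upTo N)} S∈
          bd = sublists-AllPairs (upTo N) (upTo-sorted N) sub , All.tabulate (λ i∈ → ∈-upTo⁻ (sublists-⊆ (upTo N) sub i∈))
      in treeCells-complete t 0 (to-edges bd (isCell⇒Cell N D S bd ic))

    bwd : ∀ {S} → S ∈ treeCells t 0 → S ∈ cells N D
    bwd {S} S∈ =
      let (so , bd) , c = from-edges (treeCells-sound t 0 S∈)
      in ∈-filter⁺ (T? ∘ isCell N D)
           (sorted∈sublists (upTo N) S (upTo-sorted N) so (λ i∈ → ∈-upTo⁺ (All.lookup bd i∈))) (Cell⇒isCell N D S c)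

  quiddity-decode : quiddity N D ≡ decode (word t [])
  quiddity-decode = trans (map-cong (λ i → ↭-length (filter-↭ _ cells↭)) (upTo N))
    (trans (cong (λ n → map (occ (treeCells t 0)) (upTo n)) (sym end-is)) (sym (decode-word t)))

  threePeriodic⁻ : T (threePeriodic N D) → All (λ S → 3 ∣ length S) (treeCells t 0)
  threePeriodic⁻ p = All.tabulate λ {S} S∈ → m%n≡0⇒n∣m (length S) 3
    (≡ᵇ⇒≡ (length S % 3) 0 (All.lookup (All.all⁺ _ (cells N D) p) (∈-resp-↭ (↭-sym cells↭) S∈)))

  threePeriodic⁺ : All (λ S → 3 ∣ length S) (treeCells t 0) → T (threePeriodic N D)
  threePeriodic⁺ p = All.all⁻ _ (All.tabulate λ {S} S∈ →
    ≡⇒≡ᵇ (length S % 3) 0 (n∣m⇒m%n≡0 (length S) 3 (All.lookup p (∈-resp-↭ cells↭ S∈))))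

dissection⇒tree : ∀ r {D} → D ∈ dissections (2 + r) → ∃ λ t → Represents (2 + r) D t
dissection⇒tree r {D} D∈ =
  let t , e , s , c = tree-of-chords N (λ i j → T (isEdge N D (i , j))) (λ i j → T? (isEdge N D (i , j)))
        (λ i → edge i (suc i) (inj₁ (isSide⁺ N i (suc i) (inj₁ refl)))) noncrossing
        (suc r) (s≤s z≤n) ≤-refl (edge 0 (suc r) (inj₁ (isSide⁺ N 0 (suc r) (inj₂ (refl , refl)))))
  in t , record { end-is = cong suc e ; edge⇒ = λ i<j j<N → c i<j (≤-pred j<N) ; edge⇐ = s }
  where
  N = 2 + r
  D∈′ = ∈-filter⁻ (T? ∘ nonCrossing) {xs = sublists (diagonals N)} D∈
  edge : ∀ i j → T (isSide N (i , j)) ⊎ T (mem D (i , j)) → T (isEdge N D (i , j))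
  edge i j = from (T-∨ {isSide N (i , j)})
  noncrossing : ∀ {a b c d} → a < c → c < b → b < d → d < N → T (isEdge N D (a , b)) →
    T (isEdge N D (c , d)) → ⊥
  noncrossing {a} {b} {c} {d} a<c c<b b<d d<N ab cd
    with to (T-∨ {isSide N (a , b)}) ab | to (T-∨ {isSide N (c , d)}) cd
  ... | inj₂ p | inj₂ q = nonCrossing⁻ D (proj₂ D∈′) (mem⇒∈ D {a , b} p) (mem⇒∈ D {c , d} q) (crosses⁺ a<c c<b b<d)
  -- A side crosses nothing: no vertex lies strictly between i and i+1, and none lies outside the
  -- range from 0 to N-1.
  ... | inj₁ p | _ with isSide⁻ N a b p
  ...   | inj₁ refl          = <⇒≱ a<c (≤-pred c<b)
  ...   | inj₂ (refl , refl) = <⇒≱ b<d (≤-pred d<N)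
  noncrossing {a} {b} {c} {d} a<c c<b b<d d<N ab cd | inj₂ _ | inj₁ q with isSide⁻ N c d q
  ...   | inj₁ refl       = <⇒≱ c<b (≤-pred b<d)
  ...   | inj₂ (refl , _) = n≮0 a<c

tree⇒dissection : ∀ t → ∃ λ D → D ∈ dissections (suc (treeEnd t 0)) × Represents (suc (treeEnd t 0)) D t
tree⇒dissection t = D ,
  ∈-filter⁺ (T? ∘ nonCrossing) (filter∈sublists _ (diagonals N)) (nonCrossing⁺ D noncrossing) ,
  record { end-is = refl ; edge⇒ = edge⇒ ; edge⇐ = edge⇐ }
  where
  N = suc (treeEnd t 0)
  -- Filtering `diagonals N`, rather than the edges of the tree, gives a list in the order that
  -- `sublists` produces.
  D = filterᵇ (mem (treeEdges t 0)) (diagonals N)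
  D⊆edges : ∀ {c} → c ∈ D → c ∈ treeEdges t 0
  D⊆edges c∈ = mem⇒∈ (treeEdges t 0) (proj₂ (∈-filter⁻ (T? ∘ mem (treeEdges t 0)) {xs = diagonals N} c∈))
  noncrossing : ∀ {c d} → c ∈ D → d ∈ D → ¬ T (crosses c d)
  noncrossing {a , b} {c , d} p q x with crosses⁻ a b c d x
  ... | inj₁ (a<c , c<b , b<d) = treeEdges-noncrossing t 0 (D⊆edges p) (D⊆edges q) a<c c<b b<d
  ... | inj₂ (c<a , a<d , d<b) = treeEdges-noncrossing t 0 (D⊆edges q) (D⊆edges p) c<a a<d d<b
  edge⇒ : ∀ {i j} → i < j → j < N → T (isEdge N D (i , j)) → (i , j) ∈ treeEdges t 0
  edge⇒ {i} {j} i<j j<N e with to (T-∨ {isSide N (i , j)}) e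
  ... | inj₂ m = D⊆edges (mem⇒∈ D m)
  ... | inj₁ s with isSide⁻ N i j s
  ...   | inj₁ refl          = side∈treeEdges t 0 z≤n (≤-pred j<N)
  ...   | inj₂ (refl , refl) = root∈treeEdges t 0
  edge⇐ : ∀ {i j} → (i , j) ∈ treeEdges t 0 → T (isEdge N D (i , j))
  edge⇐ {i} {j} e with T? (isSide N (i , j))
  ... | yes s = from (T-∨ {isSide N (i , j)}) (inj₁ s)
  ... | no ¬s = let _ , i<j , j≤ = treeEdges-bounds t 0 e in
    from (T-∨ {isSide N (i , j)}) (inj₂ (∈⇒mem (∈-filter⁺ (T? ∘ mem (treeEdges t 0)) (∈-diagonals⁺ N i<j (s≤s j≤) ¬s) (∈⇒mem e))))

-- Reduction of trees

toVec : {A : Set} {n : ℕ} (xs : List A) → length xs ≡ n → ∃ λ (v : Vec A n) → toList v ≡ xs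
toVec xs refl = fromList xs , toList∘fromList xs

3∣3+k : ∀ {k} → 3 ∣ suc (2 + k) → ∃ λ q → k ≡ q * 3
3∣3+k (divides (suc q) eq) = q , +-cancelˡ-≡ 3 _ _ eq

mutual
  -- A single child may turn into several: the walk around it can return to the parent cell, leaving
  -- one reduced tree followed by new siblings. Their number is a multiple of 3, so the number of
  -- children of the parent is kept modulo 3.
  reduce : ∀ t l → All (λ S → 3 ∣ length S) (treeCells t l) →
    ∃ λ r → ∃ λ rs → ∃ λ m → length rs ≡ m * 3 × (∀ s → word t s ≡ code r (spine rs s))
  reduce leaf      l _        = leaf , [] , 0 , refl , λ s → refl
  reduce (node ts) l (p ∷ ps) =
    let k , v , eq = reduceRoot ts l (p ∷ ps)
        j , w , zs , m , len , eq′ = regroup k v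
    in node j w , zs , m , len , λ s → trans (eq s) (eq′ s)

  -- The root cell has no parent to which trees could move up, so its children are reduced but not
  -- regrouped, and all of them stay free.
  reduceRoot : ∀ {k} (ts : Vec Tree (2 + k)) l → All (λ S → 3 ∣ length S) (treeCells (node ts) l) →
    ∃ λ k → ∃ λ (v : Vec Reduced (2 + k * 3)) → ∀ s → words ts s ≡ spine (toList v) (corner ∷ s)
  reduceRoot ts l (p ∷ ps) =
    let rs , m , len , eq = reduces ts l ps
        q , k≡ = 3∣3+k (subst (3 ∣_) (length-path ts l) p)
        v , v≡ = toVec rs (trans len (cong (2 +_) (trans (cong (_+ m * 3) k≡) (sym (*-distribʳ-+ 3 q m)))))
    in q + m , v , λ s → trans (eq s) (cong (λ z → spine z (corner ∷ s)) (sym v≡))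

  reduces : ∀ {k} (ts : Vec Tree k) l → All (λ S → 3 ∣ length S) (forestCells ts l) →
    ∃ λ rs → ∃ λ m → length rs ≡ k + m * 3 × (∀ s → words ts s ≡ spine rs (corner ∷ s))
  reduces []       l ps = [] , 0 , refl , λ s → refl
  reduces {suc k} (t ∷ ts) l ps =
    let r , rs , m , len , eq = reduce t l (All.++⁻ˡ (treeCells t l) ps)
        rs′ , m′ , len′ , eq′ = reduces ts (treeEnd t l) (All.++⁻ʳ (treeCells t l) ps)
    in r ∷ rs ++ rs′ , m + m′ ,
       cong suc (trans (length-++ rs) (trans (cong₂ _+_ len len′) (arith k m m′))) ,
       λ s → cong (corner ∷_) (trans (eq (words ts s)) (cong (code r)
         (trans (cong (spine rs) (eq′ s)) (sym (spine-++ rs rs′ (corner ∷ s))))))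
    where
    arith : ∀ k m m′ → m * 3 + (k + m′ * 3) ≡ k + (m + m′) * 3
    arith = solve-∀

path-3∣ : ∀ k (ts : Vec Tree (2 + k * 3)) l → 3 ∣ length (path ts l)
path-3∣ k ts l = divides (suc k) (length-path ts l)

mutual
  toTree-3∣ : ∀ r l → All (λ S → 3 ∣ length S) (treeCells (toTree r) l)
  toTree-3∣ leaf l = []
  toTree-3∣ (node k (x ∷ y ∷ v)) l = path-3∣ k (toTree x ∷ toTree y ∷ toForest k v) l ∷
    All.++⁺ (toTree-3∣ x _) (All.++⁺ (toTree-3∣ y _) (toForest-3∣ k v _))

  toForest-3∣ : ∀ k v l → All (λ S → 3 ∣ length S) (forestCells (toForest k v) l)
  toForest-3∣ zero    []          l = []
  toForest-3∣ (suc k) (x ∷ y ∷ v) l = All.++⁺ (toTree-3∣ x _) (All.++⁺ (toTree-3∣ y _) (toForest-3∣ k v _))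

map-toTree-3∣ : ∀ {m} (v : Vec Reduced m) l → All (λ S → 3 ∣ length S) (forestCells (Vec.map toTree v) l)
map-toTree-3∣ []      l = []
map-toTree-3∣ (r ∷ v) l = All.++⁺ (toTree-3∣ r l) (map-toTree-3∣ v _)

words-map-toTree : ∀ {m} (v : Vec Reduced m) s → words (Vec.map toTree v) s ≡ spine (toList v) (corner ∷ s)
words-map-toTree []      s = refl
words-map-toTree (r ∷ v) s = cong (corner ∷_)
  (trans (word-toTree r _) (cong (code r) (words-map-toTree v s)))

-- Quiddities as words of root cells, and the final count

Root : Set
Root = Σ ℕ λ k → Vec Reduced (2 + k * 3)

spell : Root → Word
spell (_ , v) = spine (toList v) (corner ∷ [])

spell-injective : ∀ x y → spell x ≡ spell y → x ≡ y
spell-injective (k , v) (k′ , v′) eq = go k≡k′ v v′ lists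
  where
  lists : toList v ≡ toList v′
  lists = spine-injective (toList v) (toList v′) eq
  k≡k′ : k ≡ k′
  k≡k′ = *-cancelʳ-≡ k k′ 3 (+-cancelˡ-≡ 2 _ _
    (trans (sym (length-toList v)) (trans (cong length lists) (length-toList v′))))
  go : ∀ {k k′} → k ≡ k′ → (v : Vec Reduced (2 + k * 3)) (v′ : Vec Reduced (2 + k′ * 3)) →
    toList v ≡ toList v′ → _≡_ {A = Root} (k , v) (k′ , v′)
  go refl v v′ eq = cong (_ ,_) (trans (sym (cast-is-id refl v)) (toList-injective refl v v′ eq))

sides-spell : ∀ x → sides (spell x) ≡ suc (3 * proj₁ x + 1 + sizes (proj₂ x))
sides-spell (k , v) = trans (sides-spine v (corner ∷ [])) (arith k (sizes v))
  where
  arith : ∀ k v → 2 + k * 3 + v + 0 ≡ suc (3 * k + 1 + v)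
  arith = solve-∀

counted-unique : {A : Set} {P : A → Set} {m n : ℕ} → Counted P m → Counted P n → m ≡ n
counted-unique (counted L u s c n) (counted L′ u′ s′ c′ n′) =
  trans (sym n) (trans (↭-length (unique-↭ u u′ (c′ ∘ s) (c ∘ s′))) n′)

Quiddity : ℕ → List ℕ → Set
Quiddity N q = q ∈ map (quiddity N) (filterᵇ (threePeriodic N) (dissections N))

counted-quiddities : ∀ m → Counted (Quiddity (m + 3)) (Q (suc m))
counted-quiddities m = counted _ (deduplicate-! (≡-dec _≟_) L)
  (∈-deduplicate⁻ (≡-dec _≟_) L) (∈-deduplicate⁺ (≡-dec _≟_)) refl
  where L = map (quiddity (m + 3)) (filterᵇ (threePeriodic (m + 3)) (dissections (m + 3)))

-- Reduction changes the tree but not its word, and the word determines the quiddity.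
quiddity⇒root : ∀ m {q} → Quiddity (3 + m) q → ∃ λ x →
  3 * proj₁ x + 1 + sizes (proj₂ x) ≡ suc m × decode (spell x) ≡ q
quiddity⇒root m q∈
  with D , D∈ , refl ← ∈-map⁻ (quiddity (3 + m)) q∈
  with D∈′ , tp ← ∈-filter⁻ (T? ∘ threePeriodic (3 + m)) {xs = dissections (3 + m)} D∈
  with dissection⇒tree (suc m) D∈′
-- A leaf spans only two vertices, while the polygon has at least three.
... | leaf , rep with () ← Represents.end-is rep
... | node ts , rep =
  let k , v , eq = reduceRoot ts 0 (threePeriodic⁻ rep tp)
  in (k , v) ,
     -- The root side is not a letter, so the word of the (m+3)-gon has m+2 sides, one more than the
     -- size of the root.
     suc-injective (trans (sym (sides-spell (k , v))) (trans (cong sides (sym (eq [])))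
       (trans (sym (+-identityʳ _)) (trans (sides-word (node ts) 0 []) (suc-injective (Represents.end-is rep)))))) ,
     trans (cong decode (sym (eq []))) (sym (quiddity-decode rep))

-- Putting the leaves back turns the root into a tree whose cells all have a number of vertices
-- divisible by 3, and its dissection has the required word.
root⇒quiddity : ∀ m x → 3 * proj₁ x + 1 + sizes (proj₂ x) ≡ suc m → Quiddity (3 + m) (decode (spell x))
root⇒quiddity m x@(k , v) eq = subst (λ N → Quiddity N (decode (spell x))) end-is
  (let D , D∈ , rep = tree⇒dissection t
   in subst (Quiddity (suc (treeEnd t 0))) (trans (quiddity-decode rep) (cong decode (words-map-toTree v [])))
     (∈-map⁺ (quiddity (suc (treeEnd t 0))) (∈-filter⁺ (T? ∘ threePeriodic (suc (treeEnd t 0))) D∈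
       (threePeriodic⁺ rep (path-3∣ k ts 0 ∷ map-toTree-3∣ v 0)))))
  where
  ts = Vec.map toTree v
  t = node ts
  end-is : suc (treeEnd t 0) ≡ 3 + m
  end-is = cong suc (trans (sym (sides-word t 0 [])) (trans (+-identityʳ _)
    (trans (cong sides (words-map-toTree v [])) (trans (sides-spell x) (cong suc eq)))))

theorem2p3 : (P : Series) → (∀ n → P n ≡ Prhs P n) →
    ∀ n → Q n ≡ Qrhs P n
theorem2p3 P rec zero    = refl
-- The same quiddities are enumerated twice: by the deduplicated list that defines `Q`, and through
-- the bijection `decode ∘ spell` by the roots of size m+1.
theorem2p3 P rec (suc m) = counted-unique (counted-quiddities m)
  (subst (λ N → Counted (Quiddity N) (Qrhs P (suc m))) (+-comm 3 m)
    (counted-map (decode ∘ spell)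
      (λ {x} {y} _ _ eq → spell-injective x y (decode-injective _ _ eq))
      (λ {x} → root⇒quiddity m x) (quiddity⇒root m) (counted-roots rec m)))
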